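{- The cycle index of the $3$-group $S_9^{(3)}$ of the symmetric group $S_9$, i.e. of the action of $S_9$ on the $84$ three-element subsets of $\{1,\dots,9\}$, in the variables $a_1,a_2,\dots$, is \begin{align*} Z(S_9^{(3)}) = \frac{1}{9!} \big(& a_{1}^{84} + 36 a_{1}^{42} a_{2}^{21} + 168 a_{1}^{21} a_{3}^{21} + 378 a_{1}^{20} a_{2}^{32} + 1260 a_{1}^{10} a_{2}^{37} \\ & + 756 a_{1}^{10} a_{2}^{5} a_{4}^{16} + 2520 a_{1}^{9} a_{2}^{6} a_{3}^{11} a_{6}^{5} + 7560 a_{1}^{5} a_{2}^{8} a_{3}^{5} a_{6}^{8} + 945 a_{1}^{4} a_{2}^{40} \\ & + 7560 a_{1}^{4} a_{2}^{8} a_{4}^{16} + 3024 a_{1}^{4} a_{5}^{16} + 5600 a_{1}^{3} a_{3}^{27} + 10080 a_{1}^{3} a_{3}^{13} a_{6}^{7} \\ & + 18144 a_{1}^{2} a_{2} a_{5}^{8} a_{10}^{4} + 11340 a_{1}^{2} a_{2}^{9} a_{4}^{16} + 15120 a_{1} a_{2}^{2} a_{3}^{3} a_{4}^{4} a_{6} a_{12}^{4} \\ & + 15120 a_{1} a_{2}^{2} a_{3} a_{4}^{4} a_{6}^{2} a_{12}^{4} + 24192 a_{1} a_{3} a_{5}^{4} a_{15}^{4} + 2520 a_{1} a_{2}^{10} a_{3}^{3} a_{6}^{9} \\ & + 30240 a_{1} a_{2} a_{3}^{3} a_{6}^{12} + 30240 a_{1} a_{2} a_{3} a_{6}^{13}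 + 9072 a_{2}^{2} a_{5}^{4} a_{10}^{6} \\ & + 18144 a_{4} a_{5}^{2} a_{10} a_{20}^{3} + 25920 a_{7}^{6} a_{14}^{3} + 11340 a_{2}^{2} a_{4}^{20} + 40320 a_{3} a_{9}^{9} \\ & + 45360 a_{4} a_{8}^{10} + 25920 a_{7}^{12}\big). \end{align*}
   Context: For a permutation group $A$ on a finite set, and $\alpha\in A$, let $j_k(\alpha)$ be the number of cycles of length $k$ in the disjoint cycle decomposition of $\alpha$ (fixed points counted as cycles of length $1$). The cycle index of $A$ is the polynomial $Z(A)=\frac{1}{|A|}\sum_{\alpha\in A}\prod_{k} a_k^{j_k(\alpha)}$ in the variables $a_1,a_2,\dots$ with rational coefficients. For $1\le r\le p$, $S_p^{(r)}$ (the $r$-group of $S_p$) is the permutation group on the set of $r$-element subsets of $\{1,\dots,p\}$ formed by the permutations $\alpha'$ induced by $\alpha\in S_p$ via $\alpha'\{i_1,\dots,i_r\}=\{\alpha i_1,\dots,\alpha i_r\}$. -}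

module Defs where

open import Data.Bool.Base using (Bool; true; false; if_then_else_)
import Data.Bool.Properties as Bool
open import Data.Empty using (⊥)
open import Data.Fin.Base using (Fin; zero; suc; punchIn)
open import Data.Fin.Permutation as Perm using (Permutation′; _⟨$⟩ʳ_; _⟨$⟩ˡ_)
import Data.Fin.Properties as Fin
open import Data.Fin.Subset using (Subset; inside; outside; ∣_∣; _∈_)
open import Data.Integer.Base using (+_)
open import Data.List.Base as List using (List; []; _∷_; [_]; _++_; map; filter; length; foldr; iterate; allFin; upTo; replicate; deduplicate; cartesianProductWith)
open import Data.List.Membership.Propositional using () renaming (_∈_ to _∈ₗ_)
open import Data.List.Membership.Propositional.Properties using (∈-map⁺; ∈-map⁻; ∈-++⁺ˡ; ∈-++⁺ʳ; ∈-cartesianProductWith⁺; ∈-allFin)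
import Data.List.Membership.DecPropositional as DecMembership
import Data.List.Membership.Setoid as SetoidMembership
import Data.List.Membership.Setoid.Properties as SetoidMembershipₚ
import Data.List.Properties as List
open import Data.List.Relation.Unary.All as All using (All)
open import Data.List.Relation.Unary.Any as Any using (here; there)
import Data.List.Relation.Unary.AllPairs as AllPairs
import Data.List.Relation.Unary.Unique.DecSetoid.Properties as DecUniqueₚ
open import Data.List.Relation.Unary.Unique.Propositional using (Unique)
import Data.List.Relation.Unary.Unique.Propositional.Properties as Uniqueₚ
import Data.List.Relation.Unary.Unique.Setoid as SetoidUnique
open import Data.Nat.Base as ℕ using (ℕ; zero; suc; pred; NonZero)
import Data.Nat.Properties as ℕ
open import Data.Product.Base using (∃; _×_; _,_; proj₁; proj₂)
open import Data.Rational.Base as ℚ using (ℚ; 0ℚ; 1ℚ)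
open import Data.Vec.Base as Vec using ([]; _∷_; lookup; tabulate)
import Data.Vec.Properties as Vec
open import Algebra.Properties.CommutativeMonoid.Sum ℕ.+-0-commutativeMonoid using (sum; sum-permute; sum-cong-≗)
open import Function.Base using (_∘_)
open import Function.Bundles using (_↔_; _⇔_; mk⇔; mk↔ₛ′; Equivalence; Inverse)
open import Function.Construct.Composition using (_↔-∘_)
open import Function.Construct.Identity using (↔-id)
open import Function.Construct.Symmetry using (↔-sym)
open import Level using (0ℓ)
open import Relation.Binary.Bundles using (Setoid; DecSetoid)
open import Relation.Binary.Definitions using (DecidableEquality; Decidable)
open import Relation.Binary.PropositionalEquality.Core using (_≡_; _≗_; refl; sym; trans; cong)
open import Relation.Binary.PropositionalEquality.Properties using (module ≡-Reasoning)
open import Relation.Nullary.Decidable.Core using (yes; no; does; map′)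

-- The entry at (0-based) position i is the exponent of a_{i+1}; all
-- further exponents are 0, so lists differing only in trailing zeros
-- denote the same monomial (see _≐_).
Monomial : Set
Monomial = List ℕ

exponent : Monomial → ℕ → ℕ
exponent []      _       = 0
exponent (e ∷ m) zero    = e
exponent (e ∷ m) (suc i) = exponent m i

infix 4 _≐_ _≐?_

_≐_ : Monomial → Monomial → Set
m ≐ n = exponent m ≗ exponent n

private
  cons-≐ : ∀ {d e m n} → d ≡ e → m ≐ n → d ∷ m ≐ e ∷ n
  cons-≐ d≡e m≐n zero    = d≡e
  cons-≐ d≡e m≐n (suc i) = m≐n i

_≐?_ : Decidable _≐_
[]    ≐? []    = yes λ _ → refl
[]    ≐? e ∷ n with 0 ℕ.≟ e | [] ≐? n
... | no 0≢e  | _       = no λ eq → 0≢e (eq 0)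
... | yes _   | no []≢n = no λ eq → []≢n (eq ∘ suc)
... | yes 0≡e | yes []≐n = yes λ { zero → 0≡e ; (suc i) → []≐n i }
d ∷ m ≐? []    with d ℕ.≟ 0 | m ≐? []
... | no d≢0  | _       = no λ eq → d≢0 (eq 0)
... | yes _   | no m≢[] = no λ eq → m≢[] (eq ∘ suc)
... | yes d≡0 | yes m≐[] = yes λ { zero → d≡0 ; (suc i) → m≐[] i }
d ∷ m ≐? e ∷ n with d ℕ.≟ e | m ≐? n
... | no d≢e  | _       = no λ eq → d≢e (eq 0)
... | yes _   | no m≢n  = no λ eq → m≢n (eq ∘ suc)
... | yes d≡e | yes m≐n = yes (cons-≐ d≡e m≐n)

_*ᵐ_ : Monomial → Monomial → Monomial
[]      *ᵐ n       = n
(d ∷ m) *ᵐ []      = d ∷ m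
(d ∷ m) *ᵐ (e ∷ n) = d ℕ.+ e ∷ (m *ᵐ n)

-- Formal finite sums of terms, not necessarily reduced: the same
-- monomial may occur several times.  Equality is _≈_.
Polynomial : Set
Polynomial = List (ℚ × Monomial)

coefficient : Polynomial → Monomial → ℚ
coefficient []            m = 0ℚ
coefficient ((q , n) ∷ p) m = (if does (n ≐? m) then q else 0ℚ) ℚ.+ coefficient p m

infix  4 _≈_
infixl 6 _+_
infixl 7 _*_
infixr 7 _·_ _∙_
infixr 8 _^_

_≈_ : Polynomial → Polynomial → Set
p ≈ q = coefficient p ≗ coefficient q

0# 1# : Polynomial
0# = []
1# = [ (1ℚ , []) ]

a : (k : ℕ) .{{_ : NonZero k}} → Polynomial
a k = [ (1ℚ , replicate (pred k) 0 ++ [ 1 ]) ]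

_+_ _*_ : Polynomial → Polynomial → Polynomial
p + q = p ++ q
p * q = cartesianProductWith (λ (c , m) (d , n) → c ℚ.* d , m *ᵐ n) p q

_^_ : Polynomial → ℕ → Polynomial
p ^ zero  = 1#
p ^ suc n = p * p ^ n

_·_ : ℚ → Polynomial → Polynomial
c · p = map (λ (d , m) → c ℚ.* d , m) p

_∙_ : ℕ → Polynomial → Polynomial
n ∙ p = (+ n ℚ./ 1) · p

∑ ∏ : List Polynomial → Polynomial
∑ = foldr _+_ 0#
∏ = foldr _*_ 1#

record FiniteSet : Set₁ where
  field
    Carrier : Set
    _≟_     : DecidableEquality Carrier
    points  : List Carrier
    unique  : Unique points
    all     : ∀ x → x ∈ₗ points

module _ (X : FiniteSet) where
  open FiniteSet X

  Permutation : Set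
  Permutation = Carrier ↔ Carrier

  permutationDecSetoid : DecSetoid 0ℓ 0ℓ
  permutationDecSetoid = record
    { Carrier = Permutation
    ; _≈_     = λ α β → Inverse.to α ≗ Inverse.to β
    ; isDecEquivalence = record
      { isEquivalence = record
        { refl  = λ _ → refl
        ; sym   = λ e x → sym (e x)
        ; trans = λ e f x → trans (e x) (f x)
        }
      ; _≟_ = λ α β → map′
          (λ e x → All.lookup e (all x))
          (λ e → All.universal e points)
          (All.all? (λ x → Inverse.to α x ≟ Inverse.to β x) points)
      }
    }

  permutationSetoid : Setoid 0ℓ 0ℓ
  permutationSetoid = DecSetoid.setoid permutationDecSetoid

module _ {X : FiniteSet} where
  open FiniteSet X
  open DecMembership _≟_ using (_∈?_)

  -- The set {x, αx, α²x, …}.  The first |X| of these already exhaust it.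
  -- It is listed in the order of `points`, so that equal sets are equal
  -- as lists.
  orbit : Permutation X → Carrier → List Carrier
  orbit α x = filter (_∈? iterate (Inverse.to α) x (length points)) points

  -- The disjoint cycles of α correspond to its distinct orbits, a fixed
  -- point being an orbit of length 1.
  cycles : Permutation X → List (List Carrier)
  cycles α = deduplicate (List.≡-dec _≟_) (map (orbit α) points)

  j : ℕ → Permutation X → ℕ
  j k α = length (filter (λ c → length c ℕ.≟ k) (cycles α))

record PermutationGroup (X : FiniteSet) : Set₁ where
  private
    Carrier = FiniteSet.Carrier X
  open DecSetoid (permutationDecSetoid X) using () renaming (_≈_ to _≈ₚ_)
  open SetoidMembership (permutationSetoid X) using () renaming (_∈_ to _∈ₚ_)
  field
    Member    : Permutation X → Set
    resp      : ∀ {α β} → α ≈ₚ β → Member α → Member β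
    id-closed : Member (↔-id Carrier)
    ∘-closed  : ∀ {α β} → Member α → Member β → Member (α ↔-∘ β)
    ⁻¹-closed : ∀ {α} → Member α → Member (↔-sym α)
    elements  : List (Permutation X)
    unique    : SetoidUnique.Unique (permutationSetoid X) elements
    listed    : ∀ α → Member α ⇔ α ∈ₚ elements

  order : ℕ
  order = length elements

  order≢0 : NonZero order
  order≢0 = nonZero (↔-id Carrier) elements (Equivalence.to (listed (↔-id Carrier)) id-closed)
    where
    nonZero : ∀ α xs → α ∈ₚ xs → NonZero (length xs)
    nonZero α (x ∷ xs) _ = _

module _ {X : FiniteSet} (A : PermutationGroup X) where
  open PermutationGroup A

  -- No cycle is longer than |X|, so k ranges over 1, …, |X|.
  cycleMonomial : Permutation X → Polynomial
  cycleMonomial α = ∏ (map (λ i → a (suc i) ^ j {X} (suc i) α) (upTo (length (FiniteSet.points X))))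

  cycleIndex : Polynomial
  cycleIndex = (ℚ._/_ (+ 1) order {{order≢0}}) · ∑ (map cycleMonomial elements)

RSubset : ℕ → ℕ → Set
RSubset p r = ∃ λ (s : Subset p) → ∣ s ∣ ≡ r

RSubset-≡ : ∀ {p r} {s t : RSubset p r} → proj₁ s ≡ proj₁ t → s ≡ t
RSubset-≡ {s = s , e} {.s , f} refl = cong (s ,_) (ℕ.≡-irrelevant e f)

with-0 : ∀ {p r} → RSubset p r → RSubset (suc p) (suc r)
with-0 (s , e) = inside ∷ s , cong suc e

without-0 : ∀ {p r} → RSubset p r → RSubset (suc p) r
without-0 (s , e) = outside ∷ s , e

rSubsets : ∀ p r → List (RSubset p r)
rSubsets zero    zero    = [ ([] , refl) ]
rSubsets zero    (suc r) = []
rSubsets (suc p) zero    = map without-0 (rSubsets p zero)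
rSubsets (suc p) (suc r) = map with-0 (rSubsets p r) ++ map without-0 (rSubsets p (suc r))

private
  with-0-injective : ∀ {p r} {s t : RSubset p r} → with-0 s ≡ with-0 t → s ≡ t
  with-0-injective eq = RSubset-≡ (Vec.∷-injectiveʳ (cong proj₁ eq))

  without-0-injective : ∀ {p r} {s t : RSubset p r} → without-0 s ≡ without-0 t → s ≡ t
  without-0-injective eq = RSubset-≡ (Vec.∷-injectiveʳ (cong proj₁ eq))

rSubsets-unique : ∀ p r → Unique (rSubsets p r)
rSubsets-unique zero    zero    = All.[] AllPairs.∷ AllPairs.[]
rSubsets-unique zero    (suc r) = AllPairs.[]
rSubsets-unique (suc p) zero    = Uniqueₚ.map⁺ without-0-injective (rSubsets-unique p zero)
rSubsets-unique (suc p) (suc r) = Uniqueₚ.++⁺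
  (Uniqueₚ.map⁺ with-0-injective (rSubsets-unique p r))
  (Uniqueₚ.map⁺ without-0-injective (rSubsets-unique p (suc r)))
  λ { (v∈ , v∈′) → disjoint (∈-map⁻ with-0 v∈) (∈-map⁻ without-0 v∈′) }
  where
  disjoint : ∀ {v} → (∃ λ s → s ∈ₗ rSubsets p r × v ≡ with-0 s) →
             (∃ λ t → t ∈ₗ rSubsets p (suc r) × v ≡ without-0 t) → ⊥
  disjoint (_ , _ , refl) (_ , _ , ())

rSubsets-all : ∀ p r (s : RSubset p r) → s ∈ₗ rSubsets p r
rSubsets-all zero    zero    ([] , refl)          = here refl
rSubsets-all (suc p) zero    (outside ∷ s , e)    = ∈-map⁺ without-0 (rSubsets-all p zero (s , e))
rSubsets-all (suc p) (suc r) (outside ∷ s , e)    = ∈-++⁺ʳ _ (∈-map⁺ without-0 (rSubsets-all p (suc r) (s , e)))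
rSubsets-all (suc p) (suc r) (inside  ∷ s , refl) = ∈-++⁺ˡ (∈-map⁺ with-0 (rSubsets-all p r (s , refl)))

rSubsetsOf : ℕ → ℕ → FiniteSet
rSubsetsOf p r = record
  { Carrier = RSubset p r
  ; _≟_     = λ s t → map′ RSubset-≡ (cong proj₁) (Vec.≡-dec Bool._≟_ (proj₁ s) (proj₁ t))
  ; points  = rSubsets p r
  ; unique  = rSubsets-unique p r
  ; all     = rSubsets-all p r
  }

-- y lies in the image of s exactly when α⁻¹ y lies in s.
image : ∀ {p} → Permutation′ p → Subset p → Subset p
image α s = tabulate λ y → lookup s (α ⟨$⟩ˡ y)

∈-image : ∀ {p} (α : Permutation′ p) (s : Subset p) y →
          y ∈ image α s ⇔ (∃ λ x → x ∈ s × α ⟨$⟩ʳ x ≡ y)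
∈-image α s y = mk⇔
  (λ y∈ → α ⟨$⟩ˡ y
        , Vec.lookup⇒[]= _ s (trans (sym (Vec.lookup∘tabulate _ y)) (Vec.[]=⇒lookup y∈))
        , Perm.inverseʳ α)
  λ { (x , x∈s , refl) → Vec.lookup⇒[]= _ (image α s)
        (trans (Vec.lookup∘tabulate _ (α ⟨$⟩ʳ x))
        (trans (cong (lookup s) (Perm.inverseˡ α)) (Vec.[]=⇒lookup x∈s))) }

private
  indicator : Bool → ℕ
  indicator b = if b then 1 else 0

  ∣tabulate∣ : ∀ {n} (f : Fin n → Bool) → ∣ tabulate f ∣ ≡ sum (indicator ∘ f)
  ∣tabulate∣ {zero}  f = refl
  ∣tabulate∣ {suc n} f with f zero
  ... | true  = cong suc (∣tabulate∣ (f ∘ suc))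
  ... | false = ∣tabulate∣ (f ∘ suc)

∣image∣ : ∀ {p} (α : Permutation′ p) s → ∣ image α s ∣ ≡ ∣ s ∣
∣image∣ α s = begin
  ∣ image α s ∣                              ≡⟨ ∣tabulate∣ (λ y → lookup s (α ⟨$⟩ˡ y)) ⟩
  sum (λ y → indicator (lookup s (α ⟨$⟩ˡ y))) ≡⟨ sum-permute (indicator ∘ lookup s) (Perm.flip α) ⟨
  sum (indicator ∘ lookup s)                 ≡⟨ ∣tabulate∣ (lookup s) ⟨
  ∣ tabulate (lookup s) ∣                    ≡⟨ cong ∣_∣ (Vec.tabulate∘lookup s) ⟩
  ∣ s ∣                                      ∎
  where open ≡-Reasoning

image-cong : ∀ {p} (α β : Permutation′ p) → (∀ y → α ⟨$⟩ˡ y ≡ β ⟨$⟩ˡ y) → image α ≗ image β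
image-cong α β eq s = Vec.tabulate-cong λ y → cong (lookup s) (eq y)

image-id : ∀ {p} (s : Subset p) → image Perm.id s ≡ s
image-id = Vec.tabulate∘lookup

image-∘ : ∀ {p} (α β : Permutation′ p) s → image (α ↔-∘ β) s ≡ image α (image β s)
image-∘ α β s = Vec.tabulate-cong λ y → sym (Vec.lookup∘tabulate _ (α ⟨$⟩ˡ y))

induced : ∀ {p} r → Permutation′ p → Permutation (rSubsetsOf p r)
induced r α = mk↔ₛ′ (act α) (act (Perm.flip α))
  (λ (s , _) → RSubset-≡ (cancel α (Perm.flip α) (λ _ → Perm.inverseʳ α) s))
  (λ (s , _) → RSubset-≡ (cancel (Perm.flip α) α (λ _ → Perm.inverseˡ α) s))
  where
  act : Permutation′ _ → RSubset _ r → RSubset _ r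
  act β (s , e) = image β s , trans (∣image∣ β s) e

  cancel : ∀ β γ → (∀ y → γ ⟨$⟩ˡ (β ⟨$⟩ˡ y) ≡ y) → ∀ s → image β (image γ s) ≡ s
  cancel β γ eq s = trans (sym (image-∘ β γ s))
    (trans (image-cong (β ↔-∘ γ) Perm.id eq s) (image-id s))

permutations : ∀ p → List (Permutation′ p)
permutations zero    = [ Perm.id ]
permutations (suc p) = cartesianProductWith (Perm.insert zero) (allFin (suc p)) (permutations p)

private
  insert-cong : ∀ {m n} i k {α β : Perm.Permutation m n} → α Perm.≈ β →
                Perm.insert i k α Perm.≈ Perm.insert i k β
  insert-cong i k eq x with i Fin.≟ x
  ... | yes _  = refl
  ... | no i≢x = cong (punchIn k) (eq _)

permutations-all : ∀ p (α : Permutation′ p) → ∃ λ β → β ∈ₗ permutations p × β Perm.≈ α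
permutations-all zero    α = Perm.id , here refl , λ ()
permutations-all (suc p) α with permutations-all p (Perm.remove zero α)
... | β , β∈ , β≈ = Perm.insert zero (α ⟨$⟩ʳ zero) β
    , ∈-cartesianProductWith⁺ (Perm.insert zero) (∈-allFin (α ⟨$⟩ʳ zero)) β∈
    , λ x → trans (insert-cong zero (α ⟨$⟩ʳ zero) {β} {Perm.remove zero α} β≈ x) (Perm.insert-remove zero α x)

-- Distinct α may induce the same permutation of the r-element subsets
-- (for instance when r = p), hence the `deduplicate`.
rGroup : ∀ p r → PermutationGroup (rSubsetsOf p r)
rGroup p r = record
  { Member    = λ π → ∃ λ α → induced r α ≈ₚ π
  ; resp      = λ e (α , f) → α , λ s → trans (f s) (e s)
  ; id-closed = Perm.id , λ (s , _) → RSubset-≡ (image-id s)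
  ; ∘-closed  = λ { {π} {ρ} (α , f) (β , g) → α ↔-∘ β , λ s →
      trans (RSubset-≡ (image-∘ α β (proj₁ s))) (trans (f _) (cong (Inverse.to π) (g s))) }
  ; ⁻¹-closed = λ { {π} (α , f) → Perm.flip α , λ s →
      trans (cong (Inverse.from (induced r α)) (sym (trans (f _) (Inverse.strictlyInverseˡ π s))))
            (Inverse.strictlyInverseʳ (induced r α) _) }
  ; elements  = deduplicate _≟ₚ_ inducedList
  ; unique    = DecUniqueₚ.deduplicate-! (permutationDecSetoid X) inducedList
  ; listed    = λ π → mk⇔ (to π) (from π)
  }
  where
  X : FiniteSet
  X = rSubsetsOf p r
  open DecSetoid (permutationDecSetoid X) using () renaming (_≈_ to _≈ₚ_; _≟_ to _≟ₚ_)
  open SetoidMembership (permutationSetoid X) using () renaming (_∈_ to _∈ₚ_)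

  inducedList : List (Permutation X)
  inducedList = map (induced r) (permutations p)

  from-≡ : (α β : Permutation′ p) → α Perm.≈ β → ∀ y → α ⟨$⟩ˡ y ≡ β ⟨$⟩ˡ y
  from-≡ α β eq y = begin
    α ⟨$⟩ˡ y                       ≡⟨ cong (α ⟨$⟩ˡ_) (Perm.inverseʳ β) ⟨
    α ⟨$⟩ˡ (β ⟨$⟩ʳ (β ⟨$⟩ˡ y))     ≡⟨ cong (α ⟨$⟩ˡ_) (eq (β ⟨$⟩ˡ y)) ⟨
    α ⟨$⟩ˡ (α ⟨$⟩ʳ (β ⟨$⟩ˡ y))     ≡⟨ Perm.inverseˡ α ⟩
    β ⟨$⟩ˡ y                       ∎
    where open ≡-Reasoning

  to : ∀ π → (∃ λ α → induced r α ≈ₚ π) → π ∈ₚ deduplicate _≟ₚ_ inducedList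
  to π (α , f) with permutations-all p α
  ... | β , β∈ , β≈α = SetoidMembershipₚ.∈-deduplicate⁺ (permutationSetoid X) {R = _≈ₚ_} _≟ₚ_
    (λ {ρ} {σ} {τ} e f s → trans (f s) (sym (e s))) {inducedList} {π}
    (Any.map {P = induced r β ≡_} (λ { refl s → sym (trans (RSubset-≡ (image-cong β α (from-≡ β α β≈α) (proj₁ s))) (f s)) })
             (∈-map⁺ (induced r) β∈))

  from : ∀ π → π ∈ₚ deduplicate _≟ₚ_ inducedList → ∃ λ α → induced r α ≈ₚ π
  from π π∈ = search (permutations p) (SetoidMembershipₚ.∈-deduplicate⁻ (permutationSetoid X) {R = _≈ₚ_} _≟ₚ_ inducedList {π} π∈)
    where
    search : ∀ αs → π ∈ₚ map (induced r) αs → ∃ λ α → induced r α ≈ₚ π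
    search (α ∷ αs) (here e)  = α , λ s → sym (e s)
    search (α ∷ αs) (there i) = search αs i

{-# OPTIONS --safe #-}

-- If orbits are sorted by length, those of length k cover exactly the points
-- whose least period under α is k, so the cycle type of α can be read off the
-- periods of the points; it is invariant under conjugation.  Every element of
-- S_{n+1} is (0 k) ∘ β for a unique k and a unique β fixing 0, and when F is a
-- class function on S_{n+1}, so is β ↦ Σ_k F ((0 k) ∘ β) on S_n.  Sums of class
-- functions over S_n are therefore computed by recursion on n, merging
-- conjugate terms as soon as they appear; for n = 9 this leaves 30 terms.
-- S_9 acts faithfully on the 3-subsets, so the cycle index is the sum over S_9
-- of the induced cycle types.

module Submission where

open import Data.Nat.Base as ℕ using (ℕ; zero; suc; pred; NonZero; _!)
open import Data.Nat.Properties as ℕ using (_!≢0)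

open import Algebra.Properties.CommutativeSemigroup ℕ.+-commutativeSemigroup using (x∙yz≈y∙xz)
open import Data.Bool.Base using (Bool; true; false; if_then_else_)
import Data.Bool.Properties as Bool
open import Data.Fin.Base using (Fin; zero; suc; toℕ)
open import Data.Fin.Permutation as Perm using (Permutation′; _⟨$⟩ʳ_; _⟨$⟩ˡ_)
import Data.Fin.Permutation.Components as Components
import Data.Fin.Properties as Fin
open import Data.Fin.Subset using (Subset)
open import Data.Integer.Base as ℤ using (+_)
import Data.Integer.Properties as ℤ
open import Data.List.Base as List using (List; []; _∷_; [_]; _++_; map; filter; length; concat; concatMap; foldr; head; drop; applyUpTo; upTo; replicate; allFin; cartesianProductWith)
open import Data.List.Membership.Propositional using (_∈_)
open import Data.List.Membership.Propositional.Properties using (∈-map⁺; ∈-map⁻; ∈-filter⁺; ∈-filter⁻; ∈-applyUpTo⁺; ∈-applyUpTo⁻; ∈-concat⁺′; ∈-concat⁻′; ∈-deduplicate⁺; ∈-deduplicate⁻; ∈-allFin; ∈-cartesianProductWith⁺)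
import Data.List.Membership.Setoid as SetoidMembership
import Data.List.Properties as List
open import Data.List.Relation.Unary.All as All using (All; []; _∷_)
import Data.List.Relation.Unary.All.Properties as All
open import Data.List.Relation.Unary.AllPairs using (AllPairs; []; _∷_)
open import Data.List.Relation.Unary.Any as Any using (Any; here; there; _─_)
import Data.List.Relation.Unary.Any.Properties as Any
import Data.List.Relation.Unary.Unique.DecPropositional.Properties as DecUnique
open import Data.List.Relation.Unary.Unique.Propositional using (Unique)
import Data.List.Relation.Unary.Unique.Propositional.Properties as Unique
import Data.List.Relation.Unary.Unique.Setoid as SetoidUnique
import Data.List.Relation.Unary.Unique.Setoid.Properties as SetoidUniqueₚ
open import Data.Maybe.Base using (fromMaybe)
open import Data.Nat.DivMod using (_%_; m≡m%n+[m/n]*n; m%n<n; m*n/n≡m; m*n%n≡0) renaming (_/_ to _div_)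
open import Data.Nat.GeneralisedArithmetic using (iterate)
open import Data.Nat.ListAction using (sum)
open import Data.Nat.ListAction.Properties using (sum-++)
open import Data.Product.Base using (∃; _×_; _,_; proj₁; proj₂)
open import Data.Rational.Base as ℚ using (ℚ; 0ℚ; 1ℚ; toℚᵘ; _/_)
import Data.Rational.Properties as ℚ
open import Data.Rational.Unnormalised.Base as ℚᵘ using (mkℚᵘ; *≡*)
import Data.Rational.Unnormalised.Properties as ℚᵘ
open import Data.Vec.Base as Vec using (Vec; lookup)
import Data.Vec.Properties as Vec
open import Function.Base using (_∘_; const; id)
open import Function.Bundles using (Inverse; Equivalence; mk⇔)
open import Function.Construct.Composition using (_↔-∘_)
open import Function.Construct.Identity using (↔-id)
open import Function.Definitions using (Injective)
open import Level using (0ℓ)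
open import Relation.Binary.Bundles using (Setoid)
open import Relation.Binary.Core using (Rel)
open import Relation.Binary.Definitions using (DecidableEquality)
open import Relation.Binary.PropositionalEquality hiding ([_])
open import Relation.Nullary.Decidable using (Dec; does; yes; no; map′; _×-dec_; _→-dec_; ¬?; dec-true; dec-false; does-⇔; toWitness)
open import Relation.Nullary.Negation using (¬_; contradiction)
open import Relation.Unary using (Pred; Decidable)

open import Defs

-- Finite sums over lists without repetitions

-- Two notions in the statement resist evaluation: `elements` deduplicates 9! permutations of 84
-- points, and equality of polynomials ranges over all monomials. Neither is computed. `elements` is
-- exchanged for another repetition-free list with the same members, which changes no sum; each
-- coefficient becomes a natural-number count before sums are rearranged; and two weighted lists
-- that agree at the monomials occurring in either of them agree everywhere, since both vanish
-- elsewhere. What remains for the type checker is one induced cycle type per conjugacy class and a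
-- finite comparison. The conjugacies behind the merging are not derived from a general theorem: a
-- representative and a conjugator are guessed and every guess is tested, so a wrong guess could at
-- worst leave terms unmerged.

module _ (S : Setoid 0ℓ 0ℓ) where
  open Setoid S using () renaming (Carrier to A; _≈_ to _≋_; refl to ≋-refl; sym to ≋-sym; trans to ≋-trans)
  open SetoidMembership S using () renaming (_∈_ to _∈ₛ_)
  open SetoidUnique S using () renaming (Unique to Uniqueₛ)

  private
    ∈-─⁺ : ∀ {x z xs} (p : x ∈ₛ xs) → z ∈ₛ xs → ¬ z ≋ x → z ∈ₛ (xs ─ p)
    ∈-─⁺ (here x≋y) (here z≋y) z≉x = contradiction (≋-trans z≋y (≋-sym x≋y)) z≉x
    ∈-─⁺ (here _)   (there q)  _   = q
    ∈-─⁺ (there p)  (here z≋y) _   = here z≋y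
    ∈-─⁺ (there p)  (there q)  z≉x = there (∈-─⁺ p q z≉x)

    ∈-─⁻ : ∀ {x z xs} (p : x ∈ₛ xs) → z ∈ₛ (xs ─ p) → z ∈ₛ xs
    ∈-─⁻ (here _)  q         = there q
    ∈-─⁻ (there p) (here e)  = here e
    ∈-─⁻ (there p) (there q) = there (∈-─⁻ p q)

    unique-─ : ∀ {x xs} (p : x ∈ₛ xs) → Uniqueₛ xs → Uniqueₛ (xs ─ p)
    unique-─ (here _)  (_ ∷ u) = u
    unique-─ (there p) (d ∷ u) = All.─⁺ p d ∷ unique-─ p u

    ∉-─ : ∀ {x z xs} (p : x ∈ₛ xs) → Uniqueₛ xs → z ∈ₛ (xs ─ p) → ¬ z ≋ x
    ∉-─ (here x≋y) (d ∷ _) q z≋x =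
      All.All¬⇒¬Any d (Any.map (≋-trans (≋-sym (≋-trans z≋x x≋y))) q)
    ∉-─ (there p) (d ∷ _) (here z≋y) z≋x =
      All.All¬⇒¬Any d (Any.map (≋-trans (≋-sym (≋-trans (≋-sym z≋x) z≋y))) p)
    ∉-─ (there p) (_ ∷ u) (there q) = ∉-─ p u q

  module _ {F : A → ℕ} (F-cong : ∀ {x y} → x ≋ y → F x ≡ F y) where

    sum-─ : ∀ {x xs} (p : x ∈ₛ xs) → sum (map F xs) ≡ F x ℕ.+ sum (map F (xs ─ p))
    sum-─ {xs = y ∷ xs} (here x≋y) = cong (ℕ._+ sum (map F xs)) (F-cong (≋-sym x≋y))
    sum-─ {x} {y ∷ xs} (there p) = begin
      F y ℕ.+ sum (map F xs)                   ≡⟨ cong (F y ℕ.+_) (sum-─ p) ⟩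
      F y ℕ.+ (F x ℕ.+ sum (map F (xs ─ p)))   ≡⟨ x∙yz≈y∙xz (F y) (F x) _ ⟩
      F x ℕ.+ (F y ℕ.+ sum (map F (xs ─ p)))   ∎
      where open ≡-Reasoning

    -- Such lists are rearrangements of each other: the head of `xs` is deleted from `ys` and the
    -- tails still have the same members. A setoid is used because group elements are distinct only
    -- up to pointwise equality.
    sum-unique : ∀ {xs ys} → Uniqueₛ xs → Uniqueₛ ys →
                 (∀ {z} → z ∈ₛ xs → z ∈ₛ ys) → (∀ {z} → z ∈ₛ ys → z ∈ₛ xs) →
                 sum (map F xs) ≡ sum (map F ys)
    sum-unique {[]} {[]} _ _ _ _ = refl
    sum-unique {[]} {y ∷ ys} _ _ _ ys⊆ with ys⊆ (here ≋-refl)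
    ... | ()
    sum-unique {x ∷ xs} {ys} (d ∷ u) v xs⊆ ys⊆ =
      trans (cong (F x ℕ.+_) (sum-unique u (unique-─ p v) xs⊆′ ys⊆′)) (sym (sum-─ p))
      where
      p : x ∈ₛ ys
      p = xs⊆ (here ≋-refl)

      xs⊆′ : ∀ {z} → z ∈ₛ xs → z ∈ₛ (ys ─ p)
      xs⊆′ q = ∈-─⁺ p (xs⊆ (there q))
        λ z≋x → All.All¬⇒¬Any d (Any.map (≋-trans (≋-sym z≋x)) q)

      ys⊆′ : ∀ {z} → z ∈ₛ (ys ─ p) → z ∈ₛ xs
      ys⊆′ q with ys⊆ (∈-─⁻ p q)
      ... | here z≋x = contradiction z≋x (∉-─ p v q)
      ... | there r  = r

length-sum : ∀ {A : Set} (xs : List A) → length xs ≡ sum (map (const 1) xs)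
length-sum []       = refl
length-sum (_ ∷ xs) = cong suc (length-sum xs)

length-unique : ∀ {A : Set} {xs ys : List A} → Unique xs → Unique ys →
                (∀ {z} → z ∈ xs → z ∈ ys) → (∀ {z} → z ∈ ys → z ∈ xs) →
                length xs ≡ length ys
length-unique {xs = xs} {ys} u v xs⊆ ys⊆ = begin
  length xs               ≡⟨ length-sum xs ⟩
  sum (map (const 1) xs)  ≡⟨ sum-unique (setoid _) (const refl) u v xs⊆ ys⊆ ⟩
  sum (map (const 1) ys)  ≡⟨ length-sum ys ⟨
  length ys               ∎
  where open ≡-Reasoning

-- Needed for cycles: distinctness implies disjointness only for lists already known to be orbits.
allPairs-local : ∀ {A : Set} {P : Pred A 0ℓ} {R S : Rel A 0ℓ} →
                 (∀ {x y} → P x → P y → R x y → S x y) →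
                 ∀ {xs} → All P xs → AllPairs R xs → AllPairs S xs
allPairs-local f []       []       = []
allPairs-local f (p ∷ ps) (r ∷ rs) =
  All.zipWith (λ (q , s) → f p q s) (ps , r) ∷ allPairs-local f ps rs

length-concat : ∀ {A : Set} {k} {xss : List (List A)} → All (λ xs → length xs ≡ k) xss →
                length (concat xss) ≡ length xss ℕ.* k
length-concat []                 = refl
length-concat {xss = xs ∷ xss} (e ∷ es) =
  trans (List.length-++ xs) (cong₂ ℕ._+_ e (length-concat es))

filter-map : ∀ {A B : Set} {P : Pred B 0ℓ} (P? : Decidable P) (f : A → B) xs →
             filter P? (map f xs) ≡ map f (filter (P? ∘ f) xs)
filter-map P? f []       = refl
filter-map P? f (x ∷ xs) with does (P? (f x))
... | true  = cong (f x ∷_) (filter-map P? f xs)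
... | false = filter-map P? f xs

-- Iteration and return times

iterate-+ : ∀ {A : Set} (f : A → A) x m n → iterate f x (m ℕ.+ n) ≡ iterate f (iterate f x m) n
iterate-+ f x zero    n = refl
iterate-+ f x (suc m) n = iterate-+ f (f x) m n

iterate-injective : ∀ {A : Set} {f : A → A} → Injective _≡_ _≡_ f →
                    ∀ n {x y} → iterate f x n ≡ iterate f y n → x ≡ y
iterate-injective inj zero    eq = eq
iterate-injective inj (suc n) eq = inj (iterate-injective inj n eq)

iterate-% : ∀ {A : Set} (f : A → A) {x} d .{{_ : NonZero d}} → iterate f x d ≡ x →
            ∀ i → iterate f x i ≡ iterate f x (i % d)
iterate-% f {x} d fix i = begin
  iterate f x i                                   ≡⟨ cong (iterate f x) (m≡m%n+[m/n]*n i d) ⟩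
  iterate f x (i % d ℕ.+ i div d ℕ.* d)             ≡⟨ cong (iterate f x) (ℕ.+-comm (i % d) _) ⟩
  iterate f x (i div d ℕ.* d ℕ.+ i % d)             ≡⟨ iterate-+ f x (i div d ℕ.* d) (i % d) ⟩
  iterate f (iterate f x (i div d ℕ.* d)) (i % d)   ≡⟨ cong (λ y → iterate f y (i % d)) (multiple (i div d)) ⟩
  iterate f x (i % d)                             ∎
  where
  open ≡-Reasoning
  multiple : ∀ k → iterate f x (k ℕ.* d) ≡ x
  multiple zero    = refl
  multiple (suc k) = begin
    iterate f x (d ℕ.+ k ℕ.* d)             ≡⟨ iterate-+ f x d (k ℕ.* d) ⟩
    iterate f (iterate f x d) (k ℕ.* d)     ≡⟨ cong (λ y → iterate f y (k ℕ.* d)) fix ⟩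
    iterate f x (k ℕ.* d)                   ≡⟨ multiple k ⟩
    x                                       ∎

module _ {A : Set} (_≟_ : DecidableEquality A) (f : A → A) where

  -- One more than the number of steps from y to x, provided that at most
  -- n steps suffice; otherwise the value is junk.
  returnTime : A → ℕ → A → ℕ
  returnTime x zero    y = 1
  returnTime x (suc n) y = if does (y ≟ x) then 1 else suc (returnTime x n (f y))

  -- The search starts at `f x`, since from `x` it would stop at once; the extra 1 in `returnTime`
  -- accounts for this step.
  period : ℕ → A → ℕ
  period n x = returnTime x n (f x)

  -- The bound `k ≤ n` ensures that the search succeeds before its fuel is spent, which excludes the
  -- junk value.
  returnTime-least : ∀ {x} n {y} k → k ℕ.≤ n → iterate f y k ≡ x →
                     ∃ λ i → returnTime x n y ≡ suc i × i ℕ.≤ k × iterate f y i ≡ x ×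
                             (∀ {l} → l ℕ.< i → iterate f y l ≢ x)
  returnTime-least zero    zero    _ eq = 0 , refl , ℕ.z≤n , eq , λ ()
  returnTime-least {x} (suc n) {y} k k≤n eq with y ≟ x
  ... | yes y≡x = 0 , refl , ℕ.z≤n , y≡x , λ ()
  ... | no  y≢x with k | k≤n
  ...   | zero   | _ = contradiction eq y≢x
  ...   | suc k′ | ℕ.s≤s k′≤n with returnTime-least n k′ k′≤n eq
  ...     | i , e , i≤k , fix , min = suc i , cong suc e , ℕ.s≤s i≤k , fix ,
    λ { {zero} _ → y≢x ; {suc l} (ℕ.s≤s l<i) → min l<i }

returnTime-map : ∀ {A B : Set} (_≟_ : DecidableEquality A) (_≟′_ : DecidableEquality B)
                 {f : A → A} {g : B → B} {e : A → B} → Injective _≡_ _≡_ e → (∀ x → e (f x) ≡ g (e x)) →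
                 ∀ x n y → returnTime _≟_ f x n y ≡ returnTime _≟′_ g (e x) n (e y)
returnTime-map _≟_ _≟′_ inj comm x zero y = refl
returnTime-map _≟_ _≟′_ {f} {g} {e} inj comm x (suc n) y with y ≟ x
... | yes refl rewrite dec-true (e x ≟′ e x) refl = refl
... | no  y≢x  rewrite dec-false (e y ≟′ e x) (y≢x ∘ inj) = cong suc
  (trans (returnTime-map _≟_ _≟′_ inj comm x n (f y)) (cong (returnTime _≟′_ g (e x) n) (comm y)))

-- Both searches have the same fuel and injectivity gives their tests the same outcomes, so even
-- junk values agree. It is applied with a conjugator as `e`, and with the projection that forgets
-- cardinality proofs.
period-map : ∀ {A B : Set} (_≟_ : DecidableEquality A) (_≟′_ : DecidableEquality B)
             {f : A → A} {g : B → B} {e : A → B} → Injective _≡_ _≡_ e → (∀ x → e (f x) ≡ g (e x)) →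
             ∀ n x → period _≟_ f n x ≡ period _≟′_ g n (e x)
period-map _≟_ _≟′_ {f} {g} {e} inj comm n x =
  trans (returnTime-map _≟_ _≟′_ inj comm x n (f x)) (cong (returnTime _≟′_ g (e x) n) (comm x))

-- Orbits

∈-iterate⁺ : ∀ {A : Set} (f : A → A) x {i n} → i ℕ.< n → iterate f x i ∈ List.iterate f x n
∈-iterate⁺ f x {zero}  (ℕ.s≤s _)   = here refl
∈-iterate⁺ f x {suc i} (ℕ.s≤s i<n) = there (∈-iterate⁺ f (f x) i<n)

∈-iterate⁻ : ∀ {A : Set} (f : A → A) x n {z} → z ∈ List.iterate f x n → ∃ λ i → z ≡ iterate f x i
∈-iterate⁻ f x (suc n) (here z≡x) = 0 , z≡x
∈-iterate⁻ f x (suc n) (there z∈) with ∈-iterate⁻ f (f x) n z∈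
... | i , e = suc i , e

module _ {X : FiniteSet} where
  open FiniteSet X

  to-injective : (α : Permutation X) → Injective _≡_ _≡_ (Inverse.to α)
  to-injective α {x} {y} eq =
    trans (sym (Inverse.strictlyInverseʳ α x)) (trans (cong (Inverse.from α) eq) (Inverse.strictlyInverseʳ α y))

  length-filter-bijection :
    (σ : Permutation X) {P Q : Pred Carrier 0ℓ} (P? : Decidable P) (Q? : Decidable Q) →
    (∀ {x} → P x → Q (Inverse.to σ x)) → (∀ {x} → Q (Inverse.to σ x) → P x) →
    length (filter P? points) ≡ length (filter Q? points)
  length-filter-bijection σ {P} {Q} P? Q? P⇒Q Q⇒P = begin
    length (filter P? points)                     ≡⟨ List.length-map to (filter P? points) ⟨
    length (map to (filter P? points))            ≡⟨ length-unique (Unique.map⁺ (to-injective σ) (Unique.filter⁺ P? unique))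
                                                       (Unique.filter⁺ Q? unique) ⊆ ⊇ ⟩
    length (filter Q? points)                     ∎
    where
    open ≡-Reasoning
    open Inverse σ using (to; from; strictlyInverseˡ)

    ⊆ : ∀ {z} → z ∈ map to (filter P? points) → z ∈ filter Q? points
    ⊆ z∈ with ∈-map⁻ to z∈
    ... | x , x∈ , refl = ∈-filter⁺ Q? (all _) (P⇒Q (proj₂ (∈-filter⁻ P? {xs = points} x∈)))

    ⊇ : ∀ {z} → z ∈ filter Q? points → z ∈ map to (filter P? points)
    ⊇ {z} z∈ = subst (_∈ _) (strictlyInverseˡ z) (∈-map⁺ to (∈-filter⁺ P? (all _)
      (Q⇒P (subst Q (sym (strictlyInverseˡ z)) (proj₂ (∈-filter⁻ Q? {xs = points} z∈))))))

  private
    N : ℕ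
    N = length points

  module _ (α : Permutation X) where
    private
      f : Carrier → Carrier
      f = Inverse.to α

      f-injective : Injective _≡_ _≡_ f
      f-injective = to-injective α

    -- Two of the `N + 1` iterates with exponents 0 to `N` occupy the same position in `points`;
    -- cancelling the smaller power of `f` turns the collision into a return to `x`.
    returns : ∀ x → ∃ λ d → suc d ℕ.≤ N × iterate f x (suc d) ≡ x
    returns x with Fin.pigeonhole (ℕ.n<1+n N) (λ i → Any.index (all (iterate f x (toℕ i))))
    ... | i , k , i<k , same = d , d<N , fix
      where
      open ≡-Reasoning
      d : ℕ
      d = toℕ k ℕ.∸ suc (toℕ i)

      k≡ : suc d ℕ.+ toℕ i ≡ toℕ k
      k≡ = trans (sym (ℕ.+-suc d (toℕ i))) (ℕ.m∸n+n≡m i<k)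

      d<N : suc d ℕ.≤ N
      d<N = ℕ.≤-trans (ℕ.m≤m+n (suc d) (toℕ i)) (subst (ℕ._≤ N) (sym k≡) (ℕ.s≤s⁻¹ (Fin.toℕ<n k)))

      f^i≡f^k : iterate f x (toℕ i) ≡ iterate f x (toℕ k)
      f^i≡f^k = begin
        iterate f x (toℕ i)                                       ≡⟨ Any.lookup-index (all (iterate f x (toℕ i))) ⟩
        List.lookup points (Any.index (all (iterate f x (toℕ i)))) ≡⟨ cong (List.lookup points) same ⟩
        List.lookup points (Any.index (all (iterate f x (toℕ k)))) ≡⟨ Any.lookup-index (all (iterate f x (toℕ k))) ⟨
        iterate f x (toℕ k)                                       ∎

      fix : iterate f x (suc d) ≡ x
      fix = iterate-injective f-injective (toℕ i) (begin
        iterate f (iterate f x (suc d)) (toℕ i)   ≡⟨ iterate-+ f x (suc d) (toℕ i) ⟨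
        iterate f x (suc d ℕ.+ toℕ i)             ≡⟨ cong (iterate f x) k≡ ⟩
        iterate f x (toℕ k)                       ≡⟨ f^i≡f^k ⟨
        iterate f x (toℕ i)                       ∎)

    iterates-exhausted : ∀ x i → iterate f x i ∈ List.iterate f x N
    iterates-exhausted x i with returns x
    ... | d , d<N , fix = subst (_∈ _) (sym (iterate-% f (suc d) fix i))
      (∈-iterate⁺ f x (ℕ.<-≤-trans (m%n<n i (suc d)) d<N))

    ∈-orbit⁺ : ∀ x i → iterate f x i ∈ orbit {X} α x
    ∈-orbit⁺ x i = ∈-filter⁺ _ (all _) (iterates-exhausted x i)

    ∈-orbit⁻ : ∀ x {z} → z ∈ orbit {X} α x → ∃ λ i → z ≡ iterate f x i
    ∈-orbit⁻ x z∈ = ∈-iterate⁻ f x N (proj₂ (∈-filter⁻ _ {xs = points} z∈))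

    orbit-≡ : ∀ {x z} → z ∈ orbit {X} α x → orbit {X} α z ≡ orbit {X} α x
    orbit-≡ {x} {z} z∈ with ∈-orbit⁻ x z∈ | returns x
    ... | i , refl | d , _ , fix = List.filter-≐ _ _ (forth , back) points
      where
      open ≡-Reasoning
      forth : ∀ {y} → y ∈ List.iterate f z N → y ∈ List.iterate f x N
      forth y∈ with ∈-iterate⁻ f z N y∈
      ... | l , refl = subst (_∈ _) (iterate-+ f x i l) (iterates-exhausted x (i ℕ.+ l))

      -- `z` lies `i` steps after `x`, and `d * i` further steps complete a multiple of the return
      -- time `suc d`, so `x` is reachable from `z`.
      fixᵢ : iterate f x (suc d ℕ.* i) ≡ x
      fixᵢ = trans (iterate-% f (suc d) fix (suc d ℕ.* i))
        (cong (iterate f x) (trans (cong (_% suc d) (ℕ.*-comm (suc d) i)) (m*n%n≡0 i (suc d))))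

      back : ∀ {y} → y ∈ List.iterate f x N → y ∈ List.iterate f z N
      back y∈ with ∈-iterate⁻ f x N y∈
      ... | l , refl = subst (_∈ _)
        (begin
          iterate f z (d ℕ.* i ℕ.+ l)               ≡⟨ iterate-+ f z (d ℕ.* i) l ⟩
          iterate f (iterate f z (d ℕ.* i)) l       ≡⟨ cong (λ y → iterate f y l) (iterate-+ f x i (d ℕ.* i)) ⟨
          iterate f (iterate f x (suc d ℕ.* i)) l   ≡⟨ cong (λ y → iterate f y l) fixᵢ ⟩
          iterate f x l                             ∎)
        (iterates-exhausted z (d ℕ.* i ℕ.+ l))

    length-orbit : ∀ x → length (orbit {X} α x) ≡ period _≟_ f N x
    length-orbit x with returns x
    ... | d , d<N , fix with returnTime-least _≟_ f N {f x} d (ℕ.<⇒≤ d<N) fix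
    ...   | i , e , _ , fixᵢ , min = begin
      length (orbit {X} α x)                   ≡⟨ length-unique (Unique.filter⁺ _ unique) distinct ⊆ ⊇ ⟩
      length (applyUpTo (iterate f x) (suc i)) ≡⟨ List.length-applyUpTo (iterate f x) (suc i) ⟩
      suc i                                    ≡⟨ e ⟨
      period _≟_ f N x                         ∎
      where
      open ≡-Reasoning
      min′ : ∀ {l} → 0 ℕ.< l → l ℕ.< suc i → iterate f x l ≢ x
      min′ {suc l} _ (ℕ.s≤s l<i) = min l<i

      -- A repetition at exponents `k < l` would, after cancelling `k` steps, be a return after
      -- `l ∸ k` steps, earlier than the first one.
      distinct : Unique (applyUpTo (iterate f x) (suc i))
      distinct = Unique.applyUpTo⁺₁ (iterate f x) (suc i) λ {k} {l} k<l l<i eq →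
        min′ (ℕ.m<n⇒0<n∸m k<l) (ℕ.≤-<-trans (ℕ.m∸n≤m l k) l<i)
          (iterate-injective f-injective k (begin
            iterate f (iterate f x (l ℕ.∸ k)) k   ≡⟨ iterate-+ f x (l ℕ.∸ k) k ⟨
            iterate f x (l ℕ.∸ k ℕ.+ k)           ≡⟨ cong (iterate f x) (ℕ.m∸n+n≡m (ℕ.<⇒≤ k<l)) ⟩
            iterate f x l                         ≡⟨ eq ⟨
            iterate f x k                         ∎))

      ⊆ : ∀ {z} → z ∈ orbit {X} α x → z ∈ applyUpTo (iterate f x) (suc i)
      ⊆ z∈ with ∈-orbit⁻ x z∈
      ... | l , refl = subst (_∈ _) (sym (iterate-% f (suc i) fixᵢ l))
        (∈-applyUpTo⁺ (iterate f x) (m%n<n l (suc i)))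

      ⊇ : ∀ {z} → z ∈ applyUpTo (iterate f x) (suc i) → z ∈ orbit {X} α x
      ⊇ z∈ with ∈-applyUpTo⁻ (iterate f x) z∈
      ... | l , _ , refl = ∈-orbit⁺ x l

    -- The orbits of length k are disjoint and their union is the set of
    -- points whose orbit has length k.
    j*k : ∀ k → j {X} k α ℕ.* k ≡ length (filter (λ x → length (orbit {X} α x) ℕ.≟ k) points)
    j*k k = begin
      j {X} k α ℕ.* k          ≡⟨ length-concat (All.map proj₂ chosen-orbit) ⟨
      length (concat chosen)   ≡⟨ length-unique concat-unique (Unique.filter⁺ ofLength? unique) ⊆ ⊇ ⟩
      length (filter ofLength? points) ∎
      where
      open ≡-Reasoning
      hasLength? : Decidable (λ (c : List Carrier) → length c ≡ k)
      hasLength? c = length c ℕ.≟ k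

      ofLength? : Decidable (λ x → length (orbit {X} α x) ≡ k)
      ofLength? x = length (orbit {X} α x) ℕ.≟ k

      chosen : List (List Carrier)
      chosen = filter hasLength? (cycles {X} α)

      ∈-chosen⁻ : ∀ {c} → c ∈ chosen → (∃ λ x → c ≡ orbit {X} α x) × length c ≡ k
      ∈-chosen⁻ c∈ with ∈-filter⁻ hasLength? {xs = cycles {X} α} c∈
      ... | c∈cycles , len with ∈-map⁻ (orbit {X} α) (∈-deduplicate⁻ (List.≡-dec _≟_) (map (orbit {X} α) points) c∈cycles)
      ...   | x , _ , eq = (x , eq) , len

      ∈-chosen⁺ : ∀ {x} → length (orbit {X} α x) ≡ k → orbit {X} α x ∈ chosen
      ∈-chosen⁺ {x} len = ∈-filter⁺ hasLength?
        (∈-deduplicate⁺ (List.≡-dec _≟_) (∈-map⁺ (orbit {X} α) (all x))) len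

      chosen-orbit : All (λ c → (∃ λ x → c ≡ orbit {X} α x) × length c ≡ k) chosen
      chosen-orbit = All.tabulate ∈-chosen⁻

      concat-unique : Unique (concat chosen)
      concat-unique = Unique.concat⁺
        (All.map (λ { ((x , refl) , _) → Unique.filter⁺ _ unique }) chosen-orbit)
        (allPairs-local
          (λ { ((x , refl) , _) ((y , refl) , _) x≢y (z∈x , z∈y) →
               x≢y (trans (sym (orbit-≡ z∈x)) (orbit-≡ z∈y)) })
          chosen-orbit
          (Unique.filter⁺ hasLength? (DecUnique.deduplicate-! (List.≡-dec _≟_) (map (orbit {X} α) points))))

      ⊆ : ∀ {z} → z ∈ concat chosen → z ∈ filter ofLength? points
      ⊆ z∈ with ∈-concat⁻′ chosen z∈
      ... | c , z∈c , c∈ with ∈-chosen⁻ c∈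
      ...   | (x , refl) , len = ∈-filter⁺ ofLength? (all _) (trans (cong length (orbit-≡ z∈c)) len)

      ⊇ : ∀ {z} → z ∈ filter ofLength? points → z ∈ concat chosen
      ⊇ {z} z∈ = ∈-concat⁺′ (∈-orbit⁺ z 0) (∈-chosen⁺ (proj₂ (∈-filter⁻ ofLength? {xs = points} z∈)))

-- The numbers of cycles of each length

-- `ps` is meant to list the periods of all points. A cycle of length k accounts for k of them, so
-- for a permutation the division is exact and counts cycles.
multiplicities : ℕ → List ℕ → Monomial
multiplicities n ps = applyUpTo (λ i → length (filter (ℕ._≟ suc i) ps) div suc i) n

cycleType : ∀ {A : Set} → DecidableEquality A → (A → A) → List A → Monomial
cycleType _≟_ f xs = multiplicities (length xs) (map (period _≟_ f (length xs)) xs)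

module _ {X : FiniteSet} where
  open FiniteSet X

  countPeriod : Permutation X → ℕ → ℕ
  countPeriod α k = length (filter (ℕ._≟ k) (map (period _≟_ (Inverse.to α) (length points)) points))

  permutationType : Permutation X → Monomial
  permutationType α = cycleType _≟_ (Inverse.to α) points

  countPeriod-filter : ∀ α k → countPeriod α k ≡
                       length (filter (λ x → period _≟_ (Inverse.to α) (length points) x ℕ.≟ k) points)
  countPeriod-filter α k = trans
    (cong length (filter-map (ℕ._≟ k) (period _≟_ (Inverse.to α) (length points)) points))
    (List.length-map _ (filter _ points))

  j-countPeriod : ∀ α i → j {X} (suc i) α ≡ countPeriod α (suc i) div suc i
  j-countPeriod α i = begin
    j {X} (suc i) α                                                ≡⟨ m*n/n≡m _ (suc i) ⟨
    j {X} (suc i) α ℕ.* suc i div suc i                              ≡⟨ cong (_div suc i) (j*k {X} α (suc i)) ⟩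
    length (filter (λ x → length (orbit {X} α x) ℕ.≟ suc i) points) div suc i
      ≡⟨ cong (λ xs → length xs div suc i) (List.filter-≐ _ _
           ((λ {x} → trans (sym (length-orbit {X} α x))) , (λ {x} → trans (length-orbit {X} α x))) points) ⟩
    length (filter (λ x → period _≟_ (Inverse.to α) (length points) x ℕ.≟ suc i) points) div suc i
      ≡⟨ cong (_div suc i) (countPeriod-filter α (suc i)) ⟨
    countPeriod α (suc i) div suc i                                  ∎
    where open ≡-Reasoning

  -- `σ` carries the points of a given period under `α` onto those under `β`. With the identity as
  -- `σ` this also shows that the type depends only on the values of the permutation.
  permutationType-conjugate : ∀ {α β} (σ : Permutation X) →
    (∀ x → Inverse.to σ (Inverse.to α x) ≡ Inverse.to β (Inverse.to σ x)) →
    permutationType α ≡ permutationType β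
  permutationType-conjugate {α} {β} σ comm = applyUpTo-cong (λ i → cong (_div suc i) (same (suc i))) (length points)
    where
    applyUpTo-cong : ∀ {f g : ℕ → ℕ} → (∀ i → f i ≡ g i) → ∀ n → applyUpTo f n ≡ applyUpTo g n
    applyUpTo-cong e zero    = refl
    applyUpTo-cong e (suc n) = cong₂ _∷_ (e 0) (applyUpTo-cong (e ∘ suc) n)

    periods : ∀ x → period _≟_ (Inverse.to α) (length points) x ≡
                    period _≟_ (Inverse.to β) (length points) (Inverse.to σ x)
    periods = period-map _≟_ _≟_ (to-injective {X} σ) comm (length points)

    same : ∀ k → countPeriod α k ≡ countPeriod β k
    same k = begin
      countPeriod α k   ≡⟨ countPeriod-filter α k ⟩
      length (filter (λ x → period _≟_ (Inverse.to α) (length points) x ℕ.≟ k) points)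
        ≡⟨ length-filter-bijection {X} σ _ _ (λ {x} → trans (sym (periods x))) (λ {x} → trans (periods x)) ⟩
      length (filter (λ x → period _≟_ (Inverse.to β) (length points) x ℕ.≟ k) points)
        ≡⟨ countPeriod-filter β k ⟨
      countPeriod β k   ∎
      where open ≡-Reasoning

-- Monomials

exponent-*ᵐ : ∀ m n i → exponent (m *ᵐ n) i ≡ exponent m i ℕ.+ exponent n i
exponent-*ᵐ []      n       i       = refl
exponent-*ᵐ (d ∷ m) []      i       = sym (ℕ.+-identityʳ _)
exponent-*ᵐ (d ∷ m) (e ∷ n) zero    = refl
exponent-*ᵐ (d ∷ m) (e ∷ n) (suc i) = exponent-*ᵐ m n i

*ᵐ-cong : ∀ {m m′ n n′} → m ≐ m′ → n ≐ n′ → m *ᵐ n ≐ m′ *ᵐ n′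
*ᵐ-cong {m} {m′} {n} {n′} e f i =
  trans (exponent-*ᵐ m n i) (trans (cong₂ ℕ._+_ (e i) (f i)) (sym (exponent-*ᵐ m′ n′ i)))

*ᵐ-replicate : ∀ s m n → (replicate s 0 ++ m) *ᵐ (replicate s 0 ++ n) ≡ replicate s 0 ++ (m *ᵐ n)
*ᵐ-replicate zero    m n = refl
*ᵐ-replicate (suc s) m n = cong (0 ∷_) (*ᵐ-replicate s m n)

replicate-∷ : ∀ s m → 0 ∷ replicate s 0 ++ m ≡ replicate s 0 ++ 0 ∷ m
replicate-∷ zero    m = refl
replicate-∷ (suc s) m = cong (0 ∷_) (replicate-∷ s m)

[]≐replicate : ∀ s {m} → [] ≐ m → [] ≐ replicate s 0 ++ m
[]≐replicate zero    e i       = e i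
[]≐replicate (suc s) e zero    = refl
[]≐replicate (suc s) e (suc i) = []≐replicate s e i

-- Zeroth powers are the empty exponent list, so the list that a product actually contains may
-- differ from the expected `m` in trailing zeros; hence one exact equation and one up to `≐`.
record IsMonomial (p : Polynomial) (m : Monomial) : Set where
  constructor isMonomial
  field
    monomial   : Monomial
    p≡monomial : p ≡ [ (1ℚ , monomial) ]
    monomial≐m : monomial ≐ m

*-isMonomial : ∀ {p q m n} → IsMonomial p m → IsMonomial q n → IsMonomial (p * q) (m *ᵐ n)
*-isMonomial {m = m} {n} (isMonomial m′ refl e) (isMonomial n′ refl f) =
  isMonomial (m′ *ᵐ n′) refl (*ᵐ-cong {m′} {m} {n′} {n} e f)

a^-isMonomial : ∀ i e → IsMonomial (a (suc i) ^ e) (replicate i 0 ++ [ e ])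
a^-isMonomial i zero    = isMonomial [] refl ([]≐replicate i λ { zero → refl ; (suc _) → refl })
a^-isMonomial i (suc e) = subst (IsMonomial _) (*ᵐ-replicate i [ 1 ] [ e ])
  (*-isMonomial {a (suc i)} (isMonomial _ refl λ _ → refl) (a^-isMonomial i e))

-- Generalised from `upTo n` for the induction: each step replaces `f` by `f ∘ suc`, and `s` records
-- the shift as leading zeros.
∏-isMonomial : ∀ (e : ℕ → ℕ) s f n → (∀ i → f i ≡ s ℕ.+ i) →
               IsMonomial (∏ (map (λ i → a (suc i) ^ e i) (applyUpTo f n)))
                          (replicate s 0 ++ applyUpTo (e ∘ f) n)
∏-isMonomial e s f zero    f≡ = isMonomial [] refl ([]≐replicate s λ _ → refl)
∏-isMonomial e s f (suc n) f≡ = subst (IsMonomial _) shift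
  (*-isMonomial
    (subst (λ i → IsMonomial (a (suc i) ^ e i) (replicate s 0 ++ [ e i ])) (sym f0≡s) (a^-isMonomial s (e s)))
    (∏-isMonomial e (suc s) (f ∘ suc) n (λ i → trans (f≡ (suc i)) (ℕ.+-suc s i))))
  where
  open ≡-Reasoning
  f0≡s : f 0 ≡ s
  f0≡s = trans (f≡ 0) (ℕ.+-identityʳ s)

  rest : Monomial
  rest = applyUpTo (e ∘ f ∘ suc) n

  shift : (replicate s 0 ++ [ e (f 0) ]) *ᵐ (replicate (suc s) 0 ++ rest) ≡ replicate s 0 ++ e (f 0) ∷ rest
  shift = begin
    (replicate s 0 ++ [ e (f 0) ]) *ᵐ (replicate (suc s) 0 ++ rest)   ≡⟨ cong ((replicate s 0 ++ [ e (f 0) ]) *ᵐ_) (replicate-∷ s rest) ⟩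
    (replicate s 0 ++ [ e (f 0) ]) *ᵐ (replicate s 0 ++ 0 ∷ rest)     ≡⟨ *ᵐ-replicate s [ e (f 0) ] (0 ∷ rest) ⟩
    replicate s 0 ++ e (f 0) ℕ.+ 0 ∷ rest                             ≡⟨ cong (λ d → replicate s 0 ++ d ∷ rest) (ℕ.+-identityʳ _) ⟩
    replicate s 0 ++ e (f 0) ∷ rest                                   ∎

-- Coefficients

fromℕ : ℕ → ℚ
fromℕ n = + n / 1

-- The detour through unnormalised rationals avoids the gcd in the normalised sum.
fromℕ-+ : ∀ m n → fromℕ (m ℕ.+ n) ≡ fromℕ m ℚ.+ fromℕ n
fromℕ-+ m n = ℚ.toℚᵘ-injective (begin
  toℚᵘ (fromℕ (m ℕ.+ n))               ≈⟨ ℚ.toℚᵘ-fromℚᵘ (mkℚᵘ (+ (m ℕ.+ n)) 0) ⟩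
  mkℚᵘ (+ (m ℕ.+ n)) 0                 ≈⟨ *≡* (cong (ℤ._* + 1) (sym (cong₂ ℤ._+_ (ℤ.*-identityʳ (+ m)) (ℤ.*-identityʳ (+ n))))) ⟩
  mkℚᵘ (+ m) 0 ℚᵘ.+ mkℚᵘ (+ n) 0       ≈⟨ ℚᵘ.+-cong (ℚ.toℚᵘ-fromℚᵘ (mkℚᵘ (+ m) 0)) (ℚ.toℚᵘ-fromℚᵘ (mkℚᵘ (+ n) 0)) ⟨
  toℚᵘ (fromℕ m) ℚᵘ.+ toℚᵘ (fromℕ n)   ≈⟨ ℚ.toℚᵘ-homo-+ (fromℕ m) (fromℕ n) ⟨
  toℚᵘ (fromℕ m ℚ.+ fromℕ n)           ∎)
  where open import Relation.Binary.Reasoning.Setoid ℚᵘ.≃-setoid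

coefficient-· : ∀ c p m → coefficient (c · p) m ≡ c ℚ.* coefficient p m
coefficient-· c []            m = sym (ℚ.*-zeroʳ c)
coefficient-· c ((d , n) ∷ p) m = begin
  (if b then c ℚ.* d else 0ℚ) ℚ.+ coefficient (c · p) m    ≡⟨ cong₂ ℚ._+_ (if-* b) (coefficient-· c p m) ⟩
  c ℚ.* (if b then d else 0ℚ) ℚ.+ c ℚ.* coefficient p m    ≡⟨ ℚ.*-distribˡ-+ c _ _ ⟨
  c ℚ.* ((if b then d else 0ℚ) ℚ.+ coefficient p m)        ∎
  where
  open ≡-Reasoning
  b : Bool
  b = does (n ≐? m)

  if-* : ∀ b → (if b then c ℚ.* d else 0ℚ) ≡ c ℚ.* (if b then d else 0ℚ)
  if-* true  = refl
  if-* false = sym (ℚ.*-zeroʳ c)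

infix 8 _at_

_at_ : Monomial → Monomial → ℕ
n at m = if does (n ≐? m) then 1 else 0

at-congˡ : ∀ {m n} → m ≐ n → ∀ l → m at l ≡ n at l
at-congˡ {m} {n} e l = cong (λ b → if b then 1 else 0)
  (does-⇔ (mk⇔ (λ f i → trans (sym (e i)) (f i)) (λ f i → trans (e i) (f i))) (m ≐? l) (n ≐? l))

at-congʳ : ∀ {m n} → m ≐ n → ∀ l → l at m ≡ l at n
at-congʳ {m} {n} e l = cong (λ b → if b then 1 else 0)
  (does-⇔ (mk⇔ (λ f i → trans (f i) (e i)) (λ f i → trans (f i) (sym (e i)))) (l ≐? m) (l ≐? n))

coefficient-∑ : ∀ {A : Set} (f : A → Polynomial) (g : A → Monomial) → (∀ x → IsMonomial (f x) (g x)) →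
                ∀ xs m → coefficient (∑ (map f xs)) m ≡ fromℕ (sum (map (λ x → g x at m) xs))
coefficient-∑ f g is []       m = refl
coefficient-∑ f g is (x ∷ xs) m with f x | is x
... | _ | isMonomial n refl n≐gx = begin
  (if does (n ≐? m) then 1ℚ else 0ℚ) ℚ.+ coefficient (∑ (map f xs)) m  ≡⟨ cong₂ ℚ._+_ (if-fromℕ (does (n ≐? m))) (coefficient-∑ f g is xs m) ⟩
  fromℕ (n at m) ℚ.+ fromℕ rest                                      ≡⟨ cong (λ c → fromℕ c ℚ.+ fromℕ rest) (at-congˡ {n} {g x} n≐gx m) ⟩
  fromℕ (g x at m) ℚ.+ fromℕ rest                                    ≡⟨ fromℕ-+ (g x at m) rest ⟨
  fromℕ ((g x at m) ℕ.+ rest)                                        ∎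
  where
  open ≡-Reasoning
  rest : ℕ
  rest = sum (map (λ x → g x at m) xs)

  if-fromℕ : ∀ b → (if b then 1ℚ else 0ℚ) ≡ fromℕ (if b then 1 else 0)
  if-fromℕ true  = refl
  if-fromℕ false = refl

module _ {X : FiniteSet} (A : PermutationGroup X) where
  open FiniteSet X
  open PermutationGroup A

  cycleMonomial-isMonomial : ∀ α → IsMonomial (cycleMonomial A α) (permutationType {X} α)
  cycleMonomial-isMonomial α = subst (IsMonomial _) (j≡ id (length points))
    (∏-isMonomial (λ i → j {X} (suc i) α) 0 id (length points) (λ _ → refl))
    where
    j≡ : ∀ (f : ℕ → ℕ) n → applyUpTo (λ i → j {X} (suc (f i)) α) n ≡
                           applyUpTo (λ i → countPeriod {X} α (suc (f i)) div suc (f i)) n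
    j≡ f zero    = refl
    j≡ f (suc n) = cong₂ _∷_ (j-countPeriod {X} α (f 0)) (j≡ (f ∘ suc) n)

  coefficient-cycleIndex : ∀ m → coefficient (cycleIndex A) m ≡
    ((+ 1) / order) {{order≢0}} ℚ.* fromℕ (sum (map (λ α → permutationType {X} α at m) elements))
  coefficient-cycleIndex m = trans
    (coefficient-· (((+ 1) / order) {{order≢0}}) (∑ (map (cycleMonomial A) elements)) m)
    (cong (((+ 1) / order) {{order≢0}} ℚ.*_)
      (coefficient-∑ (cycleMonomial A) (permutationType {X}) cycleMonomial-isMonomial elements m))

-- Weighted lists

Weighted : Set → Set
Weighted A = List (ℕ × A)

total : ∀ {A : Set} → (A → ℕ) → Weighted A → ℕ
total f ws = sum (map (λ (c , x) → c ℕ.* f x) ws)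

total-map : ∀ {A B : Set} (f : B → ℕ) (g : A → B) ws →
            total f (map (λ (c , x) → c , g x) ws) ≡ total (f ∘ g) ws
total-map f g ws = cong sum (sym (List.map-∘ ws))

total-cong : ∀ {A : Set} {f g : A → ℕ} → (∀ x → f x ≡ g x) → ∀ ws → total f ws ≡ total g ws
total-cong e ws = cong sum (List.map-cong (λ (c , x) → cong (c ℕ.*_) (e x)) ws)

polynomial : Weighted Monomial → Polynomial
polynomial = map (λ (c , n) → fromℕ c , n)

coefficient-polynomial : ∀ ws m → coefficient (polynomial ws) m ≡ fromℕ (total (_at m) ws)
coefficient-polynomial []             m = refl
coefficient-polynomial ((c , n) ∷ ws) m = begin
  (if does (n ≐? m) then fromℕ c else 0ℚ) ℚ.+ coefficient (polynomial ws) m   ≡⟨ cong₂ ℚ._+_ (if-fromℕ (does (n ≐? m))) (coefficient-polynomial ws m) ⟩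
  fromℕ (c ℕ.* (n at m)) ℚ.+ fromℕ (total (_at m) ws)                        ≡⟨ fromℕ-+ (c ℕ.* (n at m)) _ ⟨
  fromℕ (c ℕ.* (n at m) ℕ.+ total (_at m) ws)                                ∎
  where
  open ≡-Reasoning
  if-fromℕ : ∀ b → (if b then fromℕ c else 0ℚ) ≡ fromℕ (c ℕ.* (if b then 1 else 0))
  if-fromℕ true  = cong fromℕ (sym (ℕ.*-identityʳ c))
  if-fromℕ false = cong fromℕ (sym (ℕ.*-zeroʳ c))

total-absent : ∀ {ws m} → All (λ (c , n) → ¬ n ≐ m) ws → total (_at m) ws ≡ 0
total-absent []                                = refl
total-absent {(c , n) ∷ ws} {m} (n≢m ∷ absent) rewrite dec-false (n ≐? m) n≢m =
  trans (cong (ℕ._+ total (_at m) ws) (ℕ.*-zeroʳ c)) (total-absent absent)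

-- A finite test for equality of polynomials: at a monomial `≐` to no listed one both totals are 0,
-- and at any other the totals are those at a listed monomial.
AgreeOnSupport : Weighted Monomial → Weighted Monomial → Set
AgreeOnSupport ws vs = All (λ (c , m) → total (_at m) ws ≡ total (_at m) vs) (ws ++ vs)

agreeOnSupport? : ∀ ws vs → Dec (AgreeOnSupport ws vs)
agreeOnSupport? ws vs = All.all? (λ (c , m) → total (_at m) ws ℕ.≟ total (_at m) vs) (ws ++ vs)

agree : ∀ {ws vs} → AgreeOnSupport ws vs → ∀ m → total (_at m) ws ≡ total (_at m) vs
agree {ws} {vs} agr m with Any.any? (λ (c , n) → n ≐? m) (ws ++ vs)
... | yes m∈ = search agr m∈
  where
  search : ∀ {us} → All (λ (c , n) → total (_at n) ws ≡ total (_at n) vs) us →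
           Any (λ (c , n) → n ≐ m) us → total (_at m) ws ≡ total (_at m) vs
  search (e ∷ _) (here {c , n} n≐m) = trans (total-cong (λ l → sym (at-congʳ {n} {m} n≐m l)) ws)
    (trans e (total-cong (at-congʳ {n} {m} n≐m) vs))
  search (_ ∷ es) (there p) = search es p
... | no m∉ = trans (total-absent (All.++⁻ˡ ws absent)) (sym (total-absent (All.++⁻ʳ ws absent)))
  where absent = All.¬Any⇒All¬ (ws ++ vs) m∉

-- Words for permutations

-- The word k₁ ∷ k₂ ∷ … ∷ [] stands for (0 k₁) ∘ (1 1+k₂) ∘ (2 2+k₃) ∘ ….
data Code : ℕ → Set where
  []  : Code 0
  _∷_ : ∀ {n} → Fin (suc n) → Code n → Code (suc n)

_≟ᶜ_ : ∀ {n} → DecidableEquality (Code n)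
[]      ≟ᶜ []      = yes refl
(k ∷ v) ≟ᶜ (l ∷ w) =
  map′ (λ { (refl , refl) → refl }) (λ { refl → refl , refl }) (k Fin.≟ l ×-dec v ≟ᶜ w)

-- The tail is the outer index, so that a sum over words splits into inner sums over the first
-- letter, which are values of `∑-extensions`.
codes : ∀ n → List (Code n)
codes zero    = [ [] ]
codes (suc n) = cartesianProductWith (λ w k → k ∷ w) (codes n) (allFin (suc n))

-- `∘ₚ` applies its left argument first: the transposition `(0 k)` acts after the permutation that
-- fixes 0.
extend : ∀ {n} → Fin (suc n) → Permutation′ n → Permutation′ (suc n)
extend k π = Perm.lift₀ π Perm.∘ₚ Perm.transpose zero k

decode : ∀ {n} → Code n → Permutation′ n
decode []      = Perm.id
decode (k ∷ w) = extend k (decode w)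

codes-unique : ∀ n → Unique (codes n)
codes-unique zero    = All.[] ∷ []
codes-unique (suc n) = Unique.cartesianProductWith⁺ (λ w k → k ∷ w) (λ { refl → refl , refl })
  (codes-unique n) (Unique.allFin⁺ (suc n))

∈-codes : ∀ {n} (w : Code n) → w ∈ codes n
∈-codes []      = Any.here refl
∈-codes (k ∷ w) = ∈-cartesianProductWith⁺ (λ w k → k ∷ w) (∈-codes w) (∈-allFin k)

length-cartesianProductWith : ∀ {A B C : Set} (f : A → B → C) xs ys →
  length (cartesianProductWith f xs ys) ≡ length xs ℕ.* length ys
length-cartesianProductWith f []       ys = refl
length-cartesianProductWith f (x ∷ xs) ys = trans (List.length-++ (map (f x) ys))
  (cong₂ ℕ._+_ (List.length-map (f x) ys) (length-cartesianProductWith f xs ys))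

length-codes : ∀ n → length (codes n) ≡ n !
length-codes zero    = refl
length-codes (suc n) = begin
  length (codes (suc n))                          ≡⟨ length-cartesianProductWith (λ w k → k ∷ w) (codes n) (allFin (suc n)) ⟩
  length (codes n) ℕ.* length (allFin (suc n))    ≡⟨ cong₂ ℕ._*_ (length-codes n) (List.length-tabulate {n = suc n} id) ⟩
  n ! ℕ.* suc n                                   ≡⟨ ℕ.*-comm (n !) (suc n) ⟩
  suc n !                                         ∎
  where open ≡-Reasoning

⟨$⟩ʳ-injective : ∀ {n} (π : Permutation′ n) {x y} → π ⟨$⟩ʳ x ≡ π ⟨$⟩ʳ y → x ≡ y
⟨$⟩ʳ-injective π eq = trans (sym (Perm.inverseˡ π)) (trans (cong (π ⟨$⟩ˡ_) eq) (Perm.inverseˡ π))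

⟨$⟩ˡ-cong : ∀ {n} (π ρ : Permutation′ n) → π Perm.≈ ρ → ∀ y → π ⟨$⟩ˡ y ≡ ρ ⟨$⟩ˡ y
⟨$⟩ˡ-cong π ρ eq y = ⟨$⟩ʳ-injective π
  (trans (Perm.inverseʳ π) (trans (sym (Perm.inverseʳ ρ)) (sym (eq (ρ ⟨$⟩ˡ y)))))

decode-injective : ∀ {n} (v w : Code n) → decode v Perm.≈ decode w → v ≡ w
decode-injective []      []      _  = refl
decode-injective (k ∷ v) (l ∷ w) eq with eq zero
... | refl = cong (k ∷_) (decode-injective v w λ x →
  Fin.suc-injective (⟨$⟩ʳ-injective (Perm.transpose zero k) (eq (suc x))))

transpose-matchˡ : ∀ {n} (i k : Fin n) → Components.transpose i k i ≡ k
transpose-matchˡ i k rewrite dec-true (i Fin.≟ i) refl = refl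

-- The first letter must be `k = π 0`. Then `(0 k) ∘ π` fixes 0, and deleting 0 leaves a permutation
-- of `n` points.
decode-surjective : ∀ {n} (π : Permutation′ n) → ∃ λ w → decode w Perm.≈ π
decode-surjective {zero}  π = [] , λ ()
decode-surjective {suc n} π with decode-surjective (Perm.remove zero (π Perm.∘ₚ Perm.flip (Perm.transpose zero (π ⟨$⟩ʳ zero))))
... | w , eq = k ∷ w , λ x → begin
  τ ⟨$⟩ʳ (Perm.lift₀ (decode w) ⟨$⟩ʳ x)               ≡⟨ cong (τ ⟨$⟩ʳ_) (Perm.lift₀-cong (decode w) (Perm.remove zero ρ) eq x) ⟩
  τ ⟨$⟩ʳ (Perm.lift₀ (Perm.remove zero ρ) ⟨$⟩ʳ x)     ≡⟨ cong (τ ⟨$⟩ʳ_) (Perm.lift₀-remove ρ ρ0≡0 x) ⟩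
  τ ⟨$⟩ʳ (τ ⟨$⟩ˡ (π ⟨$⟩ʳ x))                          ≡⟨ Perm.inverseʳ τ ⟩
  π ⟨$⟩ʳ x                                            ∎
  where
  open ≡-Reasoning
  k : Fin (suc n)
  k = π ⟨$⟩ʳ zero

  τ ρ : Permutation′ (suc n)
  τ = Perm.transpose zero k
  ρ = π Perm.∘ₚ Perm.flip τ

  -- Flipping `transpose zero k` yields the function `transpose k zero`, which sends its first
  -- argument `k` to `zero`.
  ρ0≡0 : ρ ⟨$⟩ʳ zero ≡ zero
  ρ0≡0 = transpose-matchˡ k zero

-- Class functions

Conjugates : ∀ {n} → Permutation′ n → Permutation′ n → Permutation′ n → Set
Conjugates σ α β = ∀ x → σ ⟨$⟩ʳ (α ⟨$⟩ʳ x) ≡ β ⟨$⟩ʳ (σ ⟨$⟩ʳ x)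

record ClassFunction {n} (F : Permutation′ n → ℕ) : Set where
  constructor classFunction
  field
    invariant : ∀ σ α β → Conjugates σ α β → F α ≡ F β

open ClassFunction

-- This is `σ (i k) σ⁻¹ = (σi σk)`: by injectivity the comparisons that define the transposition
-- have the same outcome before and after applying `σ`.
transpose-natural : ∀ {n} (σ : Permutation′ n) i k x →
  σ ⟨$⟩ʳ Components.transpose i k x ≡ Components.transpose (σ ⟨$⟩ʳ i) (σ ⟨$⟩ʳ k) (σ ⟨$⟩ʳ x)
transpose-natural σ i k x
  rewrite does-⇔ (mk⇔ (⟨$⟩ʳ-injective σ) (cong (σ ⟨$⟩ʳ_))) (σ ⟨$⟩ʳ x Fin.≟ σ ⟨$⟩ʳ i) (x Fin.≟ i)
  with does (x Fin.≟ i)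
... | true  = refl
... | false
  rewrite does-⇔ (mk⇔ (⟨$⟩ʳ-injective σ) (cong (σ ⟨$⟩ʳ_))) (σ ⟨$⟩ʳ x Fin.≟ σ ⟨$⟩ʳ k) (x Fin.≟ k)
  with does (x Fin.≟ k)
...   | true  = refl
...   | false = refl

-- The lift of `σ` fixes 0, so it conjugates `(0 k)` to the transposition of 0 with the image of
-- `k`. Conjugation thus only permutes the extensions, and their sum is unchanged.
extend-conjugates : ∀ {n} (σ α β : Permutation′ n) → Conjugates σ α β →
  ∀ k → Conjugates (Perm.lift₀ σ) (extend k α) (extend (Perm.lift₀ σ ⟨$⟩ʳ k) β)
extend-conjugates σ α β comm k x = trans
  (transpose-natural (Perm.lift₀ σ) zero k (Perm.lift₀ α ⟨$⟩ʳ x))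
  (cong (Components.transpose zero (Perm.lift₀ σ ⟨$⟩ʳ k)) (lifted x))
  where
  lifted : Conjugates (Perm.lift₀ σ) (Perm.lift₀ α) (Perm.lift₀ β)
  lifted zero    = refl
  lifted (suc x) = cong suc (comm x)

∑-extensions : ∀ {n} → (Permutation′ (suc n) → ℕ) → Permutation′ n → ℕ
∑-extensions F α = sum (map (λ k → F (extend k α)) (allFin _))

sum-permute : ∀ {n} (σ : Permutation′ n) (f : Fin n → ℕ) →
              sum (map (λ k → f (σ ⟨$⟩ʳ k)) (allFin n)) ≡ sum (map f (allFin n))
sum-permute {n} σ f = trans (cong sum (List.map-∘ (allFin n)))
  (sum-unique (setoid _) {F = f} (cong f)
    (Unique.map⁺ (⟨$⟩ʳ-injective σ) (Unique.allFin⁺ n)) (Unique.allFin⁺ n)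
    (λ _ → ∈-allFin _)
    (λ {z} _ → subst (_∈ _) (Perm.inverseʳ σ) (∈-map⁺ (σ ⟨$⟩ʳ_) (∈-allFin (σ ⟨$⟩ˡ z)))))

∑-extensions-class : ∀ {n} {F : Permutation′ (suc n) → ℕ} → ClassFunction F → ClassFunction (∑-extensions F)
∑-extensions-class {F = F} class = classFunction λ σ α β comm → trans
  (cong sum (List.map-cong (λ k → invariant class (Perm.lift₀ σ) (extend k α) (extend (Perm.lift₀ σ ⟨$⟩ʳ k) β)
                                    (extend-conjugates σ α β comm k)) (allFin _)))
  (sum-permute (Perm.lift₀ σ) (λ k → F (extend k β)))

sum-cartesianProductWith : ∀ {A B C : Set} (F : C → ℕ) (f : A → B → C) xs ys →
  sum (map F (cartesianProductWith f xs ys)) ≡ sum (map (λ x → sum (map (λ y → F (f x y)) ys)) xs)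
sum-cartesianProductWith F f []       ys = refl
sum-cartesianProductWith F f (x ∷ xs) ys = begin
  sum (map F (map (f x) ys ++ cartesianProductWith f xs ys))
    ≡⟨ cong sum (List.map-++ F (map (f x) ys) _) ⟩
  sum (map F (map (f x) ys) ++ map F (cartesianProductWith f xs ys))
    ≡⟨ sum-++ (map F (map (f x) ys)) _ ⟩
  sum (map F (map (f x) ys)) ℕ.+ sum (map F (cartesianProductWith f xs ys))
    ≡⟨ cong₂ ℕ._+_ (cong sum (sym (List.map-∘ ys))) (sum-cartesianProductWith F f xs ys) ⟩
  sum (map (λ y → F (f x y)) ys) ℕ.+ sum (map (λ x → sum (map (λ y → F (f x y)) ys)) xs) ∎
  where open ≡-Reasoning

-- Conjugacy classes

Relabels : ∀ {n} → Code n → Code n → (Fin n → Fin n) → (Fin n → Fin n) → Set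
Relabels v w f g = (∀ y → f (g y) ≡ y) × (∀ x → g (f x) ≡ x) ×
                   (∀ x → f (decode v ⟨$⟩ʳ x) ≡ decode w ⟨$⟩ʳ f x)

relabels? : ∀ {n} (v w : Code n) f g → Dec (Relabels v w f g)
relabels? v w f g = Fin.all? (λ y → f (g y) Fin.≟ y) ×-dec Fin.all? (λ x → g (f x) Fin.≟ x) ×-dec
                    Fin.all? (λ x → f (decode v ⟨$⟩ʳ x) Fin.≟ decode w ⟨$⟩ʳ f x)

record Conjugate {n} (w : Code n) : Set where
  constructor conjugate
  field
    code       : Code n
    conjugator : Permutation′ n
    conjugates : Conjugates conjugator (decode code) (decode w)

open Conjugate

-- If the test fails, `w` represents itself; every guess is therefore sound.
relabel : ∀ {n} (v w : Code n) → (Fin n → Fin n) → (Fin n → Fin n) → Conjugate w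
relabel v w f g with relabels? v w f g
... | yes (fg , gf , comm) = conjugate v (Perm.permutation f g fg gf) comm
... | no _                 = conjugate w Perm.id (λ _ → refl)

-- The word of (0 1 … l₁)(l₁+1 … l₁+1+l₂) ….
blockCode : ∀ n → List ℕ → Code n
blockCode zero          _            = []
blockCode (suc n)       []           = zero ∷ blockCode n []
blockCode (suc (suc n)) (suc l ∷ ls) = suc zero ∷ blockCode (suc n) (l ∷ ls)
blockCode (suc n)       (_ ∷ ls)     = zero ∷ blockCode n ls

-- Neither this nor blockCode needs to be proved correct, since relabel tests
-- the conjugation that they suggest.
sortedCycles : ∀ {n} → (Fin n → Fin n) → List (List (Fin n))
sortedCycles {n} f = concatMap (λ l → filter (λ c → length c ℕ.≟ l) unsorted) (upTo (suc n))
  where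
  cycleOf : Fin n → List (Fin n)
  cycleOf x = List.iterate f x (period Fin._≟_ f n x)

  -- Starting only from the least element of a cycle lists each cycle once.
  unsorted : List (List (Fin n))
  unsorted = map cycleOf (filter (λ x → All.all? (x Fin.≤?_) (cycleOf x)) (allFin n))

-- Tabulating makes Agda evaluate each value only once.
memo : ∀ {n} → (Fin n → Fin n) → Fin n → Fin n
memo f = lookup (Vec.tabulate f)

-- Written one after another, the cycles of `w` label the positions 0, 1, ..., and this labelling
-- conjugates the block permutation with the same cycle lengths to `decode w`. Sorting by length
-- makes the block word depend only on the cycle type. The `fromMaybe` defaults merely make the
-- lookups total.
normalForm : ∀ {n} (w : Code n) → Conjugate w
normalForm {n} w = viaCycles (sortedCycles (memo (decode w ⟨$⟩ʳ_)))
  where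
  viaLabels : Code n → (Fin n → Fin n) → Conjugate w
  viaLabels v f = relabel v w f (memo λ y → fromMaybe y (head (filter (λ x → f x Fin.≟ y) (allFin n))))

  viaCycles : List (List (Fin n)) → Conjugate w
  -- A cycle of length l is encoded by l - 1 letters `suc zero` and a closing `zero`, hence `pred`.
  viaCycles cs = viaLabels (blockCode n (map (pred ∘ length) cs))
                           (memo λ x → fromMaybe x (head (drop (toℕ x) (concat cs))))

-- Merging weighted words

module _ {A : Set} (_≟_ : DecidableEquality A) where

  insertWeighted : ℕ → A → Weighted A → Weighted A
  insertWeighted c x []             = [ (c , x) ]
  insertWeighted c x ((d , y) ∷ ws) =
    if does (x ≟ y) then (c ℕ.+ d , y) ∷ ws else (d , y) ∷ insertWeighted c x ws

  total-insert : ∀ F c x ws → total F (insertWeighted c x ws) ≡ c ℕ.* F x ℕ.+ total F ws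
  total-insert F c x []             = refl
  total-insert F c x ((d , y) ∷ ws) with x ≟ y
  ... | yes refl = trans (cong (ℕ._+ total F ws) (ℕ.*-distribʳ-+ (F x) c d)) (ℕ.+-assoc (c ℕ.* F x) _ _)
  ... | no _     = trans (cong (d ℕ.* F y ℕ.+_) (total-insert F c x ws)) (x∙yz≈y∙xz (d ℕ.* F y) (c ℕ.* F x) _)

extensions : ∀ {n} → Weighted (Code n) → Weighted (Code (suc n))
extensions ws = cartesianProductWith (λ (c , w) k → c , k ∷ w) ws (allFin _)

collect : ∀ {n} → Weighted (Code n) → Weighted (Code n)
collect = foldr (λ (c , w) → insertWeighted _≟ᶜ_ c (code (normalForm w))) []

-- One word per partition of `n` survives, so the step from 8 to 9 normalises 22 · 9 words instead
-- of 9!.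
classes : ∀ n → Weighted (Code n)
classes zero    = [ (1 , []) ]
classes (suc n) = collect (extensions (classes n))

total-collect : ∀ {n} {F : Permutation′ n → ℕ} → ClassFunction F →
                ∀ ws → total (F ∘ decode) (collect ws) ≡ total (F ∘ decode) ws
total-collect             class []             = refl
total-collect {F = F} class ((c , w) ∷ ws) = trans
  (total-insert _≟ᶜ_ (F ∘ decode) c (code (normalForm w)) (collect ws))
  (cong₂ ℕ._+_
    (cong (c ℕ.*_) (invariant class (conjugator (normalForm w)) _ (decode w) (conjugates (normalForm w))))
    (total-collect class ws))

sum-*ˡ : ∀ {A : Set} c (f : A → ℕ) xs → sum (map (λ x → c ℕ.* f x) xs) ≡ c ℕ.* sum (map f xs)
sum-*ˡ c f []       = sym (ℕ.*-zeroʳ c)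
sum-*ˡ c f (x ∷ xs) = trans (cong (c ℕ.* f x ℕ.+_) (sum-*ˡ c f xs)) (sym (ℕ.*-distribˡ-+ c (f x) _))

sum-codes : ∀ n {F : Permutation′ n → ℕ} → ClassFunction F →
            sum (map (F ∘ decode) (codes n)) ≡ total (F ∘ decode) (classes n)
sum-codes zero    {F} class = cong (ℕ._+ 0) (sym (ℕ.+-identityʳ (F Perm.id)))
sum-codes (suc n) {F} class = begin
  sum (map (F ∘ decode) (codes (suc n)))
    ≡⟨ sum-cartesianProductWith (F ∘ decode) (λ w k → k ∷ w) (codes n) (allFin (suc n)) ⟩
  sum (map (∑-extensions F ∘ decode) (codes n))
    ≡⟨ sum-codes n {∑-extensions F} (∑-extensions-class class) ⟩
  total (∑-extensions F ∘ decode) (classes n)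
    ≡⟨ cong sum (List.map-cong (λ (c , w) → sum-*ˡ c (λ k → F (extend k (decode w))) (allFin (suc n))) (classes n)) ⟨
  sum (map (λ (c , w) → sum (map (λ k → c ℕ.* F (extend k (decode w))) (allFin (suc n)))) (classes n))
    ≡⟨ sum-cartesianProductWith (λ (c , w) → c ℕ.* F (decode w)) (λ (c , w) k → c , k ∷ w) (classes n) (allFin (suc n)) ⟨
  total (F ∘ decode) (extensions (classes n))
    ≡⟨ total-collect class (extensions (classes n)) ⟨
  total (F ∘ decode) (classes (suc n)) ∎
  where open ≡-Reasoning

-- Induced permutations

induced-conjugates : ∀ {p} r {α β} (σ : Permutation′ p) → Conjugates σ α β → ∀ s →
  Inverse.to (induced r σ) (Inverse.to (induced r α) s) ≡ Inverse.to (induced r β) (Inverse.to (induced r σ) s)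
induced-conjugates r {α} {β} σ comm (s , _) = RSubset-≡ (begin
  image σ (image α s)    ≡⟨ image-∘ σ α s ⟨
  image (σ ↔-∘ α) s      ≡⟨ image-cong (σ ↔-∘ α) (β ↔-∘ σ) (⟨$⟩ˡ-cong (σ ↔-∘ α) (β ↔-∘ σ) comm) s ⟩
  image (β ↔-∘ σ) s      ≡⟨ image-∘ β σ s ⟩
  image β (image σ s)    ∎)
  where open ≡-Reasoning

-- The table of α⁻¹ and the omission of the cardinality proofs keep the
-- evaluation cheap.
inducedType : ∀ {p} → ℕ → Permutation′ p → Monomial
inducedType {p} r α = viaTable (Vec.tabulate (α ⟨$⟩ˡ_))
  where
  viaTable : Vec (Fin p) p → Monomial
  viaTable t = cycleType (Vec.≡-dec Bool._≟_) (λ s → Vec.map (lookup s) t) (map proj₁ (rSubsets p r))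

inducedType-correct : ∀ {p} r (α : Permutation′ p) → permutationType {rSubsetsOf p r} (induced r α) ≡ inducedType r α
inducedType-correct {p} r α = cong₂ multiplicities (sym n≡) (begin
  map (period (FiniteSet._≟_ (rSubsetsOf p r)) (Inverse.to (induced r α)) (length xs)) xs
    ≡⟨ List.map-cong (λ s → trans
         (period-map (FiniteSet._≟_ (rSubsetsOf p r)) (Vec.≡-dec Bool._≟_) RSubset-≡ (λ (s , _) → Vec.tabulate-∘ (lookup s) (α ⟨$⟩ˡ_)) (length xs) s)
         (cong (λ n → period (Vec.≡-dec Bool._≟_) step n (proj₁ s)) (sym n≡))) xs ⟩
  map (period (Vec.≡-dec Bool._≟_) step (length (map proj₁ xs)) ∘ proj₁) xs
    ≡⟨ List.map-∘ xs ⟩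
  map (period (Vec.≡-dec Bool._≟_) step (length (map proj₁ xs))) (map proj₁ xs) ∎)
  where
  open ≡-Reasoning
  xs : List (RSubset p r)
  xs = rSubsets p r

  step : Subset p → Subset p
  step s = Vec.map (lookup s) (Vec.tabulate (α ⟨$⟩ˡ_))

  n≡ : length (map proj₁ xs) ≡ length xs
  n≡ = List.length-map proj₁ xs

-- Faithfulness of the action on subsets

Separating : ℕ → ℕ → Set
Separating p r = ∀ x z → x ≢ z → ∃ λ (s : RSubset p r) → lookup (proj₁ s) x ≡ true × lookup (proj₁ s) z ≡ false

-- If `α x ≠ β x`, then `z = α⁻¹ (β x)` differs from `x`. For a set `s` containing `x` but not `z`,
-- the point `β x` lies in the image of `s` under `β` but not in that under `α`.
induced-faithful : ∀ {p r} → Separating p r → ∀ (α β : Permutation′ p) →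
  (∀ s → Inverse.to (induced r α) s ≡ Inverse.to (induced r β) s) → α Perm.≈ β
induced-faithful sep α β eq x with α ⟨$⟩ʳ x Fin.≟ β ⟨$⟩ʳ x
... | yes αx≡βx = αx≡βx
... | no  αx≢βx with sep x (α ⟨$⟩ˡ (β ⟨$⟩ʳ x)) (λ x≡ → αx≢βx (trans (cong (α ⟨$⟩ʳ_) x≡) (Perm.inverseʳ α)))
...   | s , x∈s , z∉s = contradiction (begin
  true                                        ≡⟨ x∈s ⟨
  lookup (proj₁ s) x                          ≡⟨ cong (lookup (proj₁ s)) (Perm.inverseˡ β) ⟨
  lookup (proj₁ s) (β ⟨$⟩ˡ (β ⟨$⟩ʳ x))        ≡⟨ Vec.lookup∘tabulate _ (β ⟨$⟩ʳ x) ⟨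
  lookup (image β (proj₁ s)) (β ⟨$⟩ʳ x)       ≡⟨ cong (λ t → lookup (proj₁ t) (β ⟨$⟩ʳ x)) (eq s) ⟨
  lookup (image α (proj₁ s)) (β ⟨$⟩ʳ x)       ≡⟨ Vec.lookup∘tabulate _ (β ⟨$⟩ʳ x) ⟩
  lookup (proj₁ s) (α ⟨$⟩ˡ (β ⟨$⟩ʳ x))        ≡⟨ z∉s ⟩
  false                                       ∎) λ ()
  where open ≡-Reasoning

module _ {p r} (sep : Separating p r) where
  private
    X : FiniteSet
    X = rSubsetsOf p r

  open PermutationGroup (rGroup p r) using (elements; listed; order; order≢0)
  open SetoidMembership (permutationSetoid X) using () renaming (_∈_ to _∈ₚ_)

  -- Replaces the deduplicated list by one indexed by words without evaluating it: faithfulness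
  -- makes the permutations induced by distinct words distinct, and every member is induced by some
  -- word.
  sum-elements : (F : Permutation X → ℕ) →
    (∀ {π ρ} → (∀ s → Inverse.to π s ≡ Inverse.to ρ s) → F π ≡ F ρ) →
    sum (map F elements) ≡ sum (map (λ w → F (induced r (decode w))) (codes p))
  sum-elements F F-cong = trans
    (sum-unique (permutationSetoid X) {F} (λ {π} {ρ} → F-cong {π} {ρ})
      (PermutationGroup.unique (rGroup p r)) unique (λ {π} → ⊆ π) (λ {π} → ⊇ π))
    (cong sum (sym (List.map-∘ (codes p))))
    where
    inducedCodes : List (Permutation X)
    inducedCodes = map (λ w → induced r (decode w)) (codes p)

    unique : SetoidUnique.Unique (permutationSetoid X) inducedCodes
    unique = SetoidUniqueₚ.map⁺ (setoid _) (permutationSetoid X)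
      (λ {v} {w} eq → decode-injective v w (induced-faithful sep (decode v) (decode w) eq)) (codes-unique p)

    ⊆ : ∀ π → π ∈ₚ elements → π ∈ₚ inducedCodes
    ⊆ π π∈ with Equivalence.from (listed π) π∈
    ... | α , α≈π with decode-surjective α
    ...   | w , w≈α = Any.map
      (λ { refl s → trans (sym (α≈π s)) (RSubset-≡
             (image-cong α (decode w) (λ y → sym (⟨$⟩ˡ-cong (decode w) α w≈α y)) (proj₁ s))) })
      (∈-map⁺ (λ w → induced r (decode w)) (∈-codes w))

    ⊇ : ∀ π → π ∈ₚ inducedCodes → π ∈ₚ elements
    ⊇ π π∈ with Any.satisfied (Any.map⁻ π∈)
    ... | w , e = Equivalence.to (listed π) (decode w , λ s → sym (e s))

-- The cycle index of the r-group

-- Only meaningful if the coefficients of the polynomial are natural numbers.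
weights : Polynomial → Weighted Monomial
weights = map (λ (q , n) → ℤ.∣ ℚ.numerator q ∣ , n)

-- Monomials may repeat. For `p = 9`, `r = 3` the 30 classes give 28 monomials: cycle types 3+3+3
-- and 3+3+1+1+1 share one (2240 + 3360 = 5600), and so do 6+3 and 6+1+1+1 (20160 + 10080 = 30240).
typeClasses : ∀ p → ℕ → Weighted Monomial
typeClasses p r = map (λ (c , w) → c , inducedType r (decode w)) (classes p)

module _ {p r} (sep : Separating p r) where
  private
    X : FiniteSet
    X = rSubsetsOf p r

  open PermutationGroup (rGroup p r) using (elements; order; order≢0)

  order-rGroup : order ≡ p !
  order-rGroup = begin
    length elements                       ≡⟨ length-sum elements ⟩
    sum (map (const 1) elements)          ≡⟨ sum-elements sep (const 1) (λ _ → refl) ⟩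
    sum (map (const 1) (codes p))         ≡⟨ length-sum (codes p) ⟨
    length (codes p)                      ≡⟨ length-codes p ⟩
    p !                                   ∎
    where open ≡-Reasoning

  sum-types : ∀ m → sum (map (λ π → permutationType {X} π at m) elements) ≡ total (_at m) (typeClasses p r)
  sum-types m = begin
    sum (map (λ π → permutationType {X} π at m) elements)
      ≡⟨ sum-elements sep (λ π → permutationType {X} π at m)
           (λ {π} {ρ} eq → cong (_at m) (permutationType-conjugate {X} {π} {ρ} (↔-id _) eq)) ⟩
    sum (map (F ∘ decode) (codes p))
      ≡⟨ sum-codes p F-class ⟩
    total (F ∘ decode) (classes p)
      ≡⟨ total-cong (λ w → cong (_at m) (inducedType-correct r (decode w))) (classes p) ⟩
    total ((_at m) ∘ inducedType r ∘ decode) (classes p)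
      ≡⟨ total-map (_at m) (inducedType r ∘ decode) (classes p) ⟨
    total (_at m) (typeClasses p r) ∎
    where
    open ≡-Reasoning
    F : Permutation′ p → ℕ
    F α = permutationType {X} (induced r α) at m

    F-class : ClassFunction F
    F-class = classFunction λ σ α β comm → cong (_at m)
      (permutationType-conjugate {X} {induced r α} {induced r β} (induced r σ) (induced-conjugates r {α} {β} σ comm))

  -- Agreement is demanded as a boolean equation, so that checking `refl` evaluates only the outcome
  -- of the test and not the proof it carries.
  cycleIndex-≈ : ∀ q → q ≡ polynomial (weights q) →
                 does (agreeOnSupport? (typeClasses p r) (weights q)) ≡ true →
                 cycleIndex (rGroup p r) ≈ _/_ (+ 1) (p !) {{p !≢0}} · q
  cycleIndex-≈ q integral agrees m = begin
    coefficient (cycleIndex (rGroup p r)) m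
      ≡⟨ coefficient-cycleIndex (rGroup p r) m ⟩
    _/_ (+ 1) order {{order≢0}} ℚ.* fromℕ (sum (map (λ π → permutationType {X} π at m) elements))
      ≡⟨ cong₂ ℚ._*_ (1/-cong {{order≢0}} {{p !≢0}} order-rGroup)
           (cong fromℕ (trans (sum-types m) (agree {typeClasses p r} {weights q}
              (does-sound (agreeOnSupport? (typeClasses p r) (weights q)) agrees) m))) ⟩
    _/_ (+ 1) (p !) {{p !≢0}} ℚ.* fromℕ (total (_at m) (weights q))
      ≡⟨ cong (_/_ (+ 1) (p !) {{p !≢0}} ℚ.*_) (coefficient-polynomial (weights q) m) ⟨
    _/_ (+ 1) (p !) {{p !≢0}} ℚ.* coefficient (polynomial (weights q)) m
      ≡⟨ cong (λ q → _/_ (+ 1) (p !) {{p !≢0}} ℚ.* coefficient q m) integral ⟨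
    _/_ (+ 1) (p !) {{p !≢0}} ℚ.* coefficient q m
      ≡⟨ coefficient-· (_/_ (+ 1) (p !) {{p !≢0}}) q m ⟨
    coefficient (_/_ (+ 1) (p !) {{p !≢0}} · q) m ∎
    where
    open ≡-Reasoning
    1/-cong : ∀ {m n} {{_ : NonZero m}} {{_ : NonZero n}} → m ≡ n → + 1 / m ≡ + 1 / n
    1/-cong refl = refl

    does-sound : ∀ {A : Set} (a? : Dec A) → does a? ≡ true → A
    does-sound (yes a) _ = a

-- Evaluation for `p = 9` and `r = 3`

separating? : ∀ p r → Dec (Separating p r)
separating? p r = Fin.all? λ x → Fin.all? λ z → ¬? (x Fin.≟ z) →-dec
  map′ Any.satisfied (λ (s , s-separates) → Any.map (λ { refl → s-separates }) (rSubsets-all p r s))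
    (Any.any? (λ s → lookup (proj₁ s) x Bool.≟ true ×-dec lookup (proj₁ s) z Bool.≟ false) (rSubsets p r))

separating-9-3 : Separating 9 3
separating-9-3 = toWitness {a? = separating? 9 3} _

mainTheorem5 : cycleIndex (rGroup 9 3) ≈
    _/_ (+ 1) (9 !) {{9 !≢0}} ·
    (a 1 ^ 84
    + 36 ∙ (a 1 ^ 42 * a 2 ^ 21)
    + 168 ∙ (a 1 ^ 21 * a 3 ^ 21)
    + 378 ∙ (a 1 ^ 20 * a 2 ^ 32)
    + 1260 ∙ (a 1 ^ 10 * a 2 ^ 37)
    + 756 ∙ (a 1 ^ 10 * a 2 ^ 5 * a 4 ^ 16)
    + 2520 ∙ (a 1 ^ 9 * a 2 ^ 6 * a 3 ^ 11 * a 6 ^ 5)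
    + 7560 ∙ (a 1 ^ 5 * a 2 ^ 8 * a 3 ^ 5 * a 6 ^ 8)
    + 945 ∙ (a 1 ^ 4 * a 2 ^ 40)
    + 7560 ∙ (a 1 ^ 4 * a 2 ^ 8 * a 4 ^ 16)
    + 3024 ∙ (a 1 ^ 4 * a 5 ^ 16)
    + 5600 ∙ (a 1 ^ 3 * a 3 ^ 27)
    + 10080 ∙ (a 1 ^ 3 * a 3 ^ 13 * a 6 ^ 7)
    + 18144 ∙ (a 1 ^ 2 * a 2 * a 5 ^ 8 * a 10 ^ 4)
    + 11340 ∙ (a 1 ^ 2 * a 2 ^ 9 * a 4 ^ 16)
    + 15120 ∙ (a 1 * a 2 ^ 2 * a 3 ^ 3 * a 4 ^ 4 * a 6 * a 12 ^ 4)
    + 15120 ∙ (a 1 * a 2 ^ 2 * a 3 * a 4 ^ 4 * a 6 ^ 2 * a 12 ^ 4)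
    + 24192 ∙ (a 1 * a 3 * a 5 ^ 4 * a 15 ^ 4)
    + 2520 ∙ (a 1 * a 2 ^ 10 * a 3 ^ 3 * a 6 ^ 9)
    + 30240 ∙ (a 1 * a 2 * a 3 ^ 3 * a 6 ^ 12)
    + 30240 ∙ (a 1 * a 2 * a 3 * a 6 ^ 13)
    + 9072 ∙ (a 2 ^ 2 * a 5 ^ 4 * a 10 ^ 6)
    + 18144 ∙ (a 4 * a 5 ^ 2 * a 10 * a 20 ^ 3)
    + 25920 ∙ (a 7 ^ 6 * a 14 ^ 3)
    + 11340 ∙ (a 2 ^ 2 * a 4 ^ 20)
    + 40320 ∙ (a 3 * a 9 ^ 9)
    + 45360 ∙ (a 4 * a 8 ^ 10)
    + 25920 ∙ (a 7 ^ 12))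
-- The polynomial is repeated so that the two types agree syntactically;
-- otherwise Agda compares unfolded rational coefficients and runs out of memory.
mainTheorem5 = cycleIndex-≈ separating-9-3
    (a 1 ^ 84
    + 36 ∙ (a 1 ^ 42 * a 2 ^ 21)
    + 168 ∙ (a 1 ^ 21 * a 3 ^ 21)
    + 378 ∙ (a 1 ^ 20 * a 2 ^ 32)
    + 1260 ∙ (a 1 ^ 10 * a 2 ^ 37)
    + 756 ∙ (a 1 ^ 10 * a 2 ^ 5 * a 4 ^ 16)
    + 2520 ∙ (a 1 ^ 9 * a 2 ^ 6 * a 3 ^ 11 * a 6 ^ 5)
    + 7560 ∙ (a 1 ^ 5 * a 2 ^ 8 * a 3 ^ 5 * a 6 ^ 8)
    + 945 ∙ (a 1 ^ 4 * a 2 ^ 40)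
    + 7560 ∙ (a 1 ^ 4 * a 2 ^ 8 * a 4 ^ 16)
    + 3024 ∙ (a 1 ^ 4 * a 5 ^ 16)
    + 5600 ∙ (a 1 ^ 3 * a 3 ^ 27)
    + 10080 ∙ (a 1 ^ 3 * a 3 ^ 13 * a 6 ^ 7)
    + 18144 ∙ (a 1 ^ 2 * a 2 * a 5 ^ 8 * a 10 ^ 4)
    + 11340 ∙ (a 1 ^ 2 * a 2 ^ 9 * a 4 ^ 16)
    + 15120 ∙ (a 1 * a 2 ^ 2 * a 3 ^ 3 * a 4 ^ 4 * a 6 * a 12 ^ 4)
    + 15120 ∙ (a 1 * a 2 ^ 2 * a 3 * a 4 ^ 4 * a 6 ^ 2 * a 12 ^ 4)
    + 24192 ∙ (a 1 * a 3 * a 5 ^ 4 * a 15 ^ 4)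
    + 2520 ∙ (a 1 * a 2 ^ 10 * a 3 ^ 3 * a 6 ^ 9)
    + 30240 ∙ (a 1 * a 2 * a 3 ^ 3 * a 6 ^ 12)
    + 30240 ∙ (a 1 * a 2 * a 3 * a 6 ^ 13)
    + 9072 ∙ (a 2 ^ 2 * a 5 ^ 4 * a 10 ^ 6)
    + 18144 ∙ (a 4 * a 5 ^ 2 * a 10 * a 20 ^ 3)
    + 25920 ∙ (a 7 ^ 6 * a 14 ^ 3)
    + 11340 ∙ (a 2 ^ 2 * a 4 ^ 20)
    + 40320 ∙ (a 3 * a 9 ^ 9)
    + 45360 ∙ (a 4 * a 8 ^ 10)
    + 25920 ∙ (a 7 ^ 12))
    -- The first `refl` checks that all coefficients are natural numbers; the second evaluates the
    -- induced types of the class representatives and compares the totals.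
    refl refl
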